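{- Let $n\ge1$. The Haglund–Loehr zeta map of type $C_n$, $\zeta_C:\operatorname{Vert}(C_n)\to\operatorname{Diag}(C_n)$, $(\pi,u)\mapsto(\zeta_C(\pi),d_C(\pi,u))$, is a well-defined bijection.
   Context: Paths: $\mathcal L_{a,b}$ is the set of words in $\{N,E\}$ with $a$ letters $E$ and $b$ letters $N$; $\mathcal B_m$ is the set of words of length $m$ in $\{N,E\}$ all of whose prefixes have at least as many $N$'s as $E$'s. For a path, $i$ is a rise if its $i$-th $N$ is immediately followed by an $N$; $(i,j)$ is a valley if its $i$-th $E$ is immediately followed by its $j$-th $N$; moreover, if a ballot path with $i$ East steps and $j$ North steps ends with an East step, then $(i,j+1)$ also counts as a valley. For an integer vector $a=(a_1,\dots,a_n)$ and $j\ge0$: $\overrightarrow{S}^+_j(a)$ reads $a$ left to right writing $N$ for each entry $j$ and $E$ for each entry $j+1$; $\overleftarrow{S}^+_j(a)$ does the same reading right to left; $\overrightarrow{S}^-_j(a)$, $\overleftarrow{S}^-_j(a)$ do the same with $N$ for entries $-j$ and $E$ for entries $-j-1$. $\mathfrak S_n^C$ is the group of signed permutations, i.e. bijections $u$ of $\{\pm1,\dots,\pm n\}$ with $u(-i)=-u(i)$, written $[u(1),\dots,u(n)]$. For $\pi\in\mathcal L_{n,n}$ let $\lambda_i$ be the number of East steps before the $i$-th North step, and let $\mu_i=(n+1-i)-\lambda_{n+1-i}$ (type $C_n$ area vector). $\zeta_C(\pi)=\overleftarrow{S}^-_n(\mu)\overrightarrow{S}^+_n(\mu)\cdots\overleftarrow{S}^-_0(\mu)\overrightarrow{S}^+_0(\mu)\in\mathcal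 B_{2n}$. $\operatorname{Vert}(C_n)$ is the set of pairs $(\pi,u)$ with $\pi\in\mathcal L_{n,n}$, $u\in\mathfrak S_n^C$, such that $u(i)<u(i+1)$ for every rise $i$ of $\pi$, and $u(1)>0$ if $\pi$ begins with a North step. The diagonal reading word $d_C(\pi,u)\in\mathfrak S_n^C$ is the window obtained as follows: for $i=0,1,\dots,n$ in turn, first write down $-u(j)$ for all $j$ with $\mu_{n+1-j}=-i$, in order of decreasing $j$, then write down $u(j)$ for all $j$ with $\mu_{n+1-j}=i+1$, in order of increasing $j$. $\operatorname{Diag}(C_n)$ is the set of pairs $(\beta,w)$ with $\beta\in\mathcal B_{2n}$, $w\in\mathfrak S_n^C$, such that for every valley $(i,j)$ of $\beta$ we have $w(n+1-i)>w(n+1-j)$ if $j\le n$ and $w(n+1-i)>w(n-j)$ if $j>n$ (where $w(-k)=-w(k)$). -}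

module Defs where

open import Data.Nat using (ℕ; zero; suc; _+_; _∸_; _≤_; _<_)
open import Data.Integer as ℤ using (ℤ; +_; -_; ∣_∣)
open import Data.List using (List; []; _∷_; _++_; map; reverse; upTo; take; length; concatMap; filterᵇ)
open import Data.List.Relation.Binary.Permutation.Propositional using (_↭_)
open import Data.Product using (_×_; _,_)
open import Data.Bool using (Bool; true; false; if_then_else_)
open import Relation.Nullary using (does)
open import Relation.Binary.PropositionalEquality using (_≡_)

data Step : Set where
  N E : Step

countN : List Step → ℕ
countN []       = 0
countN (N ∷ xs) = suc (countN xs)
countN (E ∷ xs) = countN xs

countE : List Step → ℕ
countE []       = 0
countE (E ∷ xs) = suc (countE xs)
countE (N ∷ xs) = countE xs

InL : ℕ → ℕ → List Step → Set
InL a b π = (countE π ≡ a) × (countN π ≡ b)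

InB : ℕ → List Step → Set
InB m β = (length β ≡ m) × (∀ k → countE (take k β) ≤ countN (take k β))

-- 1-based indexing into a list of integers (0 out of range)
at : List ℤ → ℕ → ℤ
at []       _             = + 0
at (x ∷ xs) zero          = + 0
at (x ∷ xs) (suc zero)    = x
at (x ∷ xs) (suc (suc k)) = at xs (suc k)

atℕ : List ℕ → ℕ → ℕ
atℕ []       _             = 0
atℕ (x ∷ xs) zero          = 0
atℕ (x ∷ xs) (suc zero)    = x
atℕ (x ∷ xs) (suc (suc k)) = atℕ xs (suc k)

oneTo : ℕ → List ℕ
oneTo n = map suc (upTo n)

-- signed permutations, given by their window [u(1),...,u(n)]
IsSignedPerm : ℕ → List ℤ → Set
IsSignedPerm n u = map ∣_∣ u ↭ oneTo n

risesFrom : ℕ → List Step → List ℕ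
risesFrom k []             = []
risesFrom k (N ∷ N ∷ xs)   = suc k ∷ risesFrom (suc k) (N ∷ xs)
risesFrom k (N ∷ E ∷ xs)   = risesFrom (suc k) (E ∷ xs)
risesFrom k (N ∷ [])       = []
risesFrom k (E ∷ xs)       = risesFrom k xs

rises : List Step → List ℕ
rises = risesFrom 0

valleysFrom : ℕ → ℕ → List Step → List (ℕ × ℕ)
valleysFrom e k []           = []
valleysFrom e k (E ∷ N ∷ xs) = (suc e , suc k) ∷ valleysFrom (suc e) k (N ∷ xs)
valleysFrom e k (E ∷ E ∷ xs) = valleysFrom (suc e) k (E ∷ xs)
valleysFrom e k (E ∷ [])     = []
valleysFrom e k (N ∷ xs)     = valleysFrom e (suc k) xs

endsWithE : List Step → Bool
endsWithE []           = false
endsWithE (E ∷ [])     = true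
endsWithE (N ∷ [])     = false
endsWithE (x ∷ y ∷ xs) = endsWithE (y ∷ xs)

valleys : List Step → List (ℕ × ℕ)
valleys β = valleysFrom 0 0 β ++
  (if endsWithE β then (countE β , suc (countN β)) ∷ [] else [])

lamFrom : ℕ → List Step → List ℕ
lamFrom e []       = []
lamFrom e (E ∷ xs) = lamFrom (suc e) xs
lamFrom e (N ∷ xs) = e ∷ lamFrom e xs

lam : List Step → List ℕ
lam = lamFrom 0

mu : ℕ → List Step → ℕ → ℤ
mu n π i = + (suc n ∸ i) ℤ.- + atℕ (lam π) (suc n ∸ i)

muList : ℕ → List Step → List ℤ
muList n π = map (mu n π) (oneTo n)

eqℤ : ℤ → ℤ → Bool
eqℤ x y = does (x ℤ.≟ y)

Splus→ : ℕ → List ℤ → List Step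
Splus→ j = concatMap (λ x → if eqℤ x (+ j) then N ∷ [] else
                           (if eqℤ x (+ suc j) then E ∷ [] else []))

Splus← : ℕ → List ℤ → List Step
Splus← j a = Splus→ j (reverse a)

Sminus→ : ℕ → List ℤ → List Step
Sminus→ j = concatMap (λ x → if eqℤ x (- + j) then N ∷ [] else
                            (if eqℤ x (- + suc j) then E ∷ [] else []))

Sminus← : ℕ → List ℤ → List Step
Sminus← j a = Sminus→ j (reverse a)

zetaC : ℕ → List Step → List Step
zetaC n π = concatMap (λ j → Sminus← j μ ++ Splus→ j μ) (reverse (upTo (suc n)))
  where μ = muList n π

dC : ℕ → List Step → List ℤ → List ℤ
dC n π u = concatMap block (upTo (suc n))
  where
  block : ℕ → List ℤ
  block i =
    map (λ j → - at u j) (reverse (filterᵇ (λ j → eqℤ (mu n π (suc n ∸ j)) (- + i)) (oneTo n)))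
    ++ map (λ j → at u j) (filterᵇ (λ j → eqℤ (mu n π (suc n ∸ j)) (+ suc i)) (oneTo n))

startsWithN : List Step → Set
startsWithN (N ∷ _) = Data.Unit.⊤
  where import Data.Unit
startsWithN _       = Data.Empty.⊥
  where import Data.Empty

InVert : ℕ → List Step → List ℤ → Set
InVert n π u =
  InL n n π × IsSignedPerm n u
  × (∀ i → i ∈ rises π → at u i ℤ.< at u (suc i))
  × (startsWithN π → + 0 ℤ.< at u 1)
  where open import Data.List.Membership.Propositional using (_∈_)

-- (β,w) ∈ Diag(C_n), using w(-k) = -w(k)
InDiag : ℕ → List Step → List ℤ → Set
InDiag n β w =
  InB (n + n) β × IsSignedPerm n w
  × (∀ i j → (i , j) ∈ valleys β →
       (j ≤ n → at w (suc n ∸ j) ℤ.< at w (suc n ∸ i))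
       × (n < j → - at w (j ∸ n) ℤ.< at w (suc n ∸ i)))
  where open import Data.List.Membership.Propositional using (_∈_)

{-# OPTIONS --safe #-}
-- Label the height a(j) = j - λ(j) of π after its j-th North step by u(j), put a zero labelled 0 in front,
-- and split the result into its nonnegative part and the reversed, negated (levels and labels) nonpositive
-- part. Both halves are Dyck sequences of levels, i.e. preorders of plane forests. Reading ζ(π) backwards,
-- one finds for k = 0, 1, ... and each half in turn the word recording the relative order of the levels k (N)
-- and k + 1 (E), so it is a breadth-first code of the two forests, and d_C(π,u) lists the labels in that order.
-- Each E of a word reappears, with its label, as an N of the next word of the same half; hence the code splits in a unique
-- way into blocks starting with N, whose numbers of N's are known in advance (initially from #N - #E = 2 #zeros),
-- and the ballot condition says that this queue never runs empty too early.
-- Since levels increase by at most one, adjacent levels k, k + 1 in a half are exactly the factors NE of the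
-- code, which matches the rises of π (and its initial N, via the leading zero) with the valleys of ζ(π).
module Submission where

open import Defs
open import Data.Bool using (Bool; true; false; if_then_else_)
open import Data.Nat as ℕ using (ℕ; zero; suc; _≤_; z≤n; s≤s; _∸_)
import Data.Nat.Properties as ℕₚ
open import Data.Integer as ℤ using (ℤ; +_; -[1+_]; -_; ∣_∣; +≤+; -≤+; -≤-)
import Data.Integer.Properties as ℤₚ
open import Data.List
open import Data.List.Properties
open import Data.List.Membership.Propositional using (_∈_)
open import Data.List.Relation.Binary.Permutation.Propositional
  using (_↭_; ↭-refl; ↭-sym; ↭-trans; ↭-prep; module PermutationReasoning)
open import Data.List.Relation.Binary.Permutation.Propositional.Properties
  using (map⁺; ++⁺; ++⁺ˡ; ↭-reverse; ↭-length; shift; shifts)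
open import Data.List.Relation.Unary.All as All using (All; []; _∷_)
open import Data.List.Relation.Unary.Any using (here; there)
open import Data.List.Relation.Unary.Linked as Linked using (Linked; []; [-]; _∷_)
open import Data.Product using (_×_; Σ; ∃; _,_; proj₁; proj₂)
open import Data.Sum using (_⊎_; inj₁; inj₂)
open import Data.Unit using (⊤; tt)
open import Function using (_∘_; flip; id)
open import Relation.Binary.PropositionalEquality hiding ([_])
open import Relation.Nullary using (contradiction; yes; no)

-- Dyck sequences and their breadth-first codes

-- The pair (β, w) carries the same information as one labelled word R, the reverse of β. Let z = n
-- - #E, let Z be the first z entries of w and V the others. The E's of R are labelled by V. The N's
-- are labelled by w, preceded by the labels of the zeros of the nonnegative half; every zero is
-- recorded in both halves, so these are the entries of Z, negated and reversed. Thus w supplies all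
-- labels, and both conditions become conditions on R. The delicate points are the ends of the path.
-- If π begins with N, the nonnegative half starts at level 1 and lacks a root: the added zero is
-- that root, and its label 0 turns u(1) > 0 into a rise. The other half needs no addition, because
-- the height after the last N of a balanced path is nonnegative. On the side of β the added zero is
-- a virtual N after the last letter, which makes the extra valley of a final E an ordinary factor
-- EN. The definition gives that N the label -w(z+1) and compares it with w(z+1), and - y < y says
-- the same as 0 < y.

Item Letter : Set
Item   = ℕ × ℤ
Letter = Step × ℤ

Head Last : {X : Set} → (X → Set) → List X → Set
Head P []      = ⊤
Head P (x ∷ _) = P x
Last P []           = ⊤
Last P (x ∷ [])     = P x
Last P (_ ∷ y ∷ xs) = Last P (y ∷ xs)

IsZero : Item → Set
IsZero (k , _) = k ≡ 0

IsN : Letter → Set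
IsN (s , _) = s ≡ N

infix 4 _⊲_

_⊲_ : Item → Item → Set
(k , x) ⊲ (l , y) = l ≤ suc k × (l ≡ suc k → x ℤ.< y)

-- Meant for the reverse of β, where a valley EN of β appears as NE; the other three factors are
-- free.
Rise : Letter → Letter → Set
Rise (N , x) (E , y) = x ℤ.< y
Rise (N , x) (N , y) = ⊤
Rise (E , x) _       = ⊤

zeros : List Item → List ℤ
zeros []                 = []
zeros ((zero  , x) ∷ A) = x ∷ zeros A
zeros ((suc _ , _) ∷ A) = zeros A

lower : List Item → List Item
lower []                 = []
lower ((zero  , _) ∷ A) = lower A
lower ((suc k , x) ∷ A) = (k , x) ∷ lower A

base : List Item → List Letter
base []                       = []
base ((zero        , x) ∷ A) = (N , x) ∷ base A
base ((suc zero    , x) ∷ A) = (E , x) ∷ base A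
base ((suc (suc _) , _) ∷ A) = base A

labelsN labelsE : List Letter → List ℤ
labelsN []             = []
labelsN ((N , x) ∷ R) = x ∷ labelsN R
labelsN ((E , _) ∷ R) = labelsN R
labelsE []             = []
labelsE ((N , _) ∷ R) = labelsE R
labelsE ((E , x) ∷ R) = x ∷ labelsE R

bfs : ℕ → List Item → List Item → List Letter
bfs zero    A B = []
bfs (suc k) A B = base A ++ base B ++ bfs k (lower A) (lower B)

-- `A` runs one level ahead of `B`, as in the blocks of the reading word (level -i, then level i +
-- 1). So the zeros of `A` are never listed; they are represented by their copies in `B`.
order : ℕ → List Item → List Item → List ℤ
order zero    A B = []
order (suc k) A B = (zeros B ++ zeros (lower A)) ++ order k (lower A) (lower B)

-- Inverse of the pair `base`, `lower`. Levels above 1 never directly follow a 0, so they can be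
-- emitted as early as possible, before the next letter. Each E uses up one zero of the second
-- argument and takes its label; the clauses returning `[]` where the two run out of step are
-- excluded by `zeros A ≡ labelsE Y`.
weave : List Letter → List Item → List Item
weave Y               ((suc k , x) ∷ A) = (suc (suc k) , x) ∷ weave Y A
weave []              []                 = []
weave []              ((zero , _) ∷ _)  = []
weave ((N , x) ∷ Y) []                  = (0 , x) ∷ weave Y []
weave ((N , x) ∷ Y) ((zero , y) ∷ A)   = (0 , x) ∷ weave Y ((zero , y) ∷ A)
weave ((E , _) ∷ _) []                  = []
weave ((E , _) ∷ Y) ((zero , y) ∷ A)   = (1 , y) ∷ weave Y A

Below : ℕ → List Item → Set
Below k = All (λ p → proj₁ p ℕ.< k)

-- Suffixes rather than prefixes, since the code is β read backwards.
Ballot : List Letter → Set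
Ballot []      = ⊤
Ballot (l ∷ R) = length (labelsE (l ∷ R)) ≤ length (labelsN (l ∷ R)) × Ballot R

labelsN-++ : ∀ Y R → labelsN (Y ++ R) ≡ labelsN Y ++ labelsN R
labelsN-++ []            R = refl
labelsN-++ ((N , x) ∷ Y) R = cong (x ∷_) (labelsN-++ Y R)
labelsN-++ ((E , _) ∷ Y) R = labelsN-++ Y R

labelsE-++ : ∀ Y R → labelsE (Y ++ R) ≡ labelsE Y ++ labelsE R
labelsE-++ []            R = refl
labelsE-++ ((E , x) ∷ Y) R = cong (x ∷_) (labelsE-++ Y R)
labelsE-++ ((N , _) ∷ Y) R = labelsE-++ Y R

labelsN-base : ∀ A → labelsN (base A) ≡ zeros A
labelsN-base []                      = refl
labelsN-base ((zero        , x) ∷ A) = cong (x ∷_) (labelsN-base A)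
labelsN-base ((suc zero    , _) ∷ A) = labelsN-base A
labelsN-base ((suc (suc _) , _) ∷ A) = labelsN-base A

labelsE-base : ∀ A → labelsE (base A) ≡ zeros (lower A)
labelsE-base []                      = refl
labelsE-base ((zero        , _) ∷ A) = labelsE-base A
labelsE-base ((suc zero    , x) ∷ A) = cong (x ∷_) (labelsE-base A)
labelsE-base ((suc (suc _) , _) ∷ A) = labelsE-base A

≰0 : ∀ {k} {X : Set} → suc (suc k) ≤ 1 → X
≰0 (s≤s ())

head-lower : ∀ {x} A → Linked _⊲_ ((0 , x) ∷ A) → Head IsZero (lower A)
head-lower []                      _             = tt
head-lower ((zero        , _) ∷ A) (_ ∷ l)       = head-lower A l
head-lower ((suc zero    , _) ∷ A) _             = refl
head-lower ((suc (suc _) , _) ∷ A) ((r , _) ∷ _) = ≰0 r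

∷-zero : ∀ {p A} → Head IsZero A → Linked _⊲_ A → Linked _⊲_ (p ∷ A)
∷-zero {A = []}           _    _ = [-]
∷-zero {A = (_ , _) ∷ _} refl l = (z≤n , λ ()) ∷ l

mutual
  lower-linked : ∀ {A} → Linked _⊲_ A → Linked _⊲_ (lower A)
  lower-linked {[]}              _ = []
  lower-linked {(zero  , _) ∷ _} l = lower-linked (Linked.tail l)
  lower-linked {(suc _ , _) ∷ _} l = lower-linked-suc l

  lower-linked-suc : ∀ {k x A} → Linked _⊲_ ((suc k , x) ∷ A) → Linked _⊲_ ((k , x) ∷ lower A)
  lower-linked-suc {A = []}                _              = [-]
  lower-linked-suc {A = (zero  , _) ∷ A}   (_ ∷ l)        = ∷-zero (head-lower A l) (lower-linked (Linked.tail l))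
  lower-linked-suc {A = (suc _ , _) ∷ _}   ((r , s) ∷ l)  = (ℕ.s≤s⁻¹ r , s ∘ cong suc) ∷ lower-linked-suc l

mutual
  -- A 0 is followed by a 0 or a 1, so each NE of the word comes from two adjacent items. The levels
  -- above 1 that `base` skips only occur after an E, where `Rise` asks nothing.
  base-rise₀ : ∀ {x A} → Linked _⊲_ ((0 , x) ∷ A) → Linked Rise ((N , x) ∷ base A)
  base-rise₀ {A = []}                       _             = [-]
  base-rise₀ {A = (zero        , _) ∷ _}    (_ ∷ l)       = tt ∷ base-rise₀ l
  base-rise₀ {A = (suc zero    , _) ∷ _}    ((_ , s) ∷ l) = s refl ∷ base-rise₁ l
  base-rise₀ {A = (suc (suc _) , _) ∷ _}    ((r , _) ∷ _) = ≰0 r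

  base-rise₁ : ∀ {k x y A} → Linked _⊲_ ((suc k , x) ∷ A) → Linked Rise ((E , y) ∷ base A)
  base-rise₁ {A = []}                       _       = [-]
  base-rise₁ {A = (zero        , _) ∷ _}    (_ ∷ l) = tt ∷ base-rise₀ l
  base-rise₁ {A = (suc zero    , _) ∷ _}    (_ ∷ l) = tt ∷ base-rise₁ l
  base-rise₁ {A = (suc (suc _) , _) ∷ _}    (_ ∷ l) = base-rise₁ l

Dyck : List Item → Set
Dyck A = Head IsZero A × Linked _⊲_ A

lower-dyck : ∀ {A} → Dyck A → Dyck (lower A)
lower-dyck {[]}             _          = tt , []
lower-dyck {(_ , _) ∷ A}   (refl , l) = head-lower A l , lower-linked l

base-head : ∀ {A} → Dyck A → Head IsN (base A)
base-head {[]}           _          = tt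
base-head {(_ , _) ∷ _} (refl , _) = refl

base-rise : ∀ {A} → Dyck A → Linked Rise (base A)
base-rise {[]}           _          = []
base-rise {(_ , _) ∷ _} (refl , l) = base-rise₀ l

head-++ : ∀ {X : Set} {P : X → Set} {xs ys : List X} → Head P xs → Head P ys → Head P (xs ++ ys)
head-++ {xs = []}    _ q = q
head-++ {xs = _ ∷ _} p _ = p

-- A block starting with N creates no factor NE at the seam.
rise-++ : ∀ Y {R} → Linked Rise Y → Linked Rise R → Head IsN R → Linked Rise (Y ++ R)
rise-++ []                    _       r _    = r
rise-++ (_ ∷ []) {[]}         _       _ _    = [-]
rise-++ ((N , _) ∷ []) {_ ∷ _}  _     r refl = tt ∷ r
rise-++ ((E , _) ∷ []) {_ ∷ _}  _     r refl = tt ∷ r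
rise-++ (_ ∷ y ∷ Y)           (s ∷ l) r h    = s ∷ rise-++ (y ∷ Y) l r h

linked-++⁻ˡ : ∀ {X : Set} {S : X → X → Set} xs {ys} → Linked S (xs ++ ys) → Linked S xs
linked-++⁻ˡ []           _       = []
linked-++⁻ˡ (_ ∷ [])     _       = [-]
linked-++⁻ˡ (_ ∷ x ∷ xs) (s ∷ l) = s ∷ linked-++⁻ˡ (x ∷ xs) l

linked-++⁻ʳ : ∀ {X : Set} {S : X → X → Set} xs {ys} → Linked S (xs ++ ys) → Linked S ys
linked-++⁻ʳ []       l = l
linked-++⁻ʳ (_ ∷ xs) l = linked-++⁻ʳ xs (Linked.tail l)

bfs-head : ∀ k {A B} → Dyck A → Dyck B → Head IsN (bfs k A B)
bfs-head zero    _ _ = tt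
bfs-head (suc k) {A} {B} a b =
  head-++ {xs = base A} (base-head a) (head-++ {xs = base B} (base-head b) (bfs-head k (lower-dyck a) (lower-dyck b)))

bfs-rise : ∀ k {A B} → Dyck A → Dyck B → Linked Rise (bfs k A B)
bfs-rise zero    _ _ = []
bfs-rise (suc k) {A} {B} a b =
  rise-++ (base A) (base-rise a)
    (rise-++ (base B) (base-rise b) (bfs-rise k a′ b′) (bfs-head k a′ b′))
    (head-++ {xs = base B} (base-head b) (bfs-head k a′ b′))
  where
  a′ = lower-dyck a
  b′ = lower-dyck b

below-lower : ∀ {k A} → Below (suc k) A → Below k (lower A)
below-lower {A = []}              _           = []
below-lower {A = (zero  , _) ∷ _} (_ ∷ b)     = below-lower b
below-lower {A = (suc _ , _) ∷ _} (p ∷ b)     = ℕ.s≤s⁻¹ p ∷ below-lower b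

below-zero : ∀ {A} → Below 0 A → A ≡ []
below-zero []       = refl

-- Every item occurs once as an N, and each item of positive level also as an E one block earlier in
-- its half. Blocks alternate in the same way for both letters, so the two lists of labels agree in
-- order, apart from the initial zeros.
labelsN-bfs : ∀ k A B → Below k A → Below k B →
  labelsN (bfs k A B) ≡ zeros A ++ zeros B ++ labelsE (bfs k A B)
labelsN-bfs zero    A B a b rewrite below-zero a | below-zero b = refl
labelsN-bfs (suc k) A B a b = begin
  labelsN (base A ++ base B ++ R)
    ≡⟨ labelsN-++ (base A) _ ⟩
  labelsN (base A) ++ labelsN (base B ++ R)
    ≡⟨ cong₂ _++_ (labelsN-base A) (trans (labelsN-++ (base B) R) (cong₂ _++_ (labelsN-base B) ih)) ⟩
  zeros A ++ zeros B ++ zeros (lower A) ++ zeros (lower B) ++ labelsE R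
    ≡⟨ cong (λ v → zeros A ++ zeros B ++ v) (cong₂ _++_ (labelsE-base A) (cong (_++ labelsE R) (labelsE-base B))) ⟨
  zeros A ++ zeros B ++ labelsE (base A) ++ labelsE (base B) ++ labelsE R
    ≡⟨ cong (λ v → zeros A ++ zeros B ++ v) (trans (labelsE-++ (base A) _) (cong (labelsE (base A) ++_) (labelsE-++ (base B) R))) ⟨
  zeros A ++ zeros B ++ labelsE (base A ++ base B ++ R) ∎
  where
  open ≡-Reasoning
  R  = bfs k (lower A) (lower B)
  ih = labelsN-bfs k (lower A) (lower B) (below-lower a) (below-lower b)

labelsN-order : ∀ k A B → Below k A → labelsN (bfs k A B) ≡ zeros A ++ order k A B
labelsN-order zero    A B a rewrite below-zero a = refl
labelsN-order (suc k) A B a = begin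
  labelsN (base A ++ base B ++ R)
    ≡⟨ labelsN-++ (base A) _ ⟩
  labelsN (base A) ++ labelsN (base B ++ R)
    ≡⟨ cong₂ _++_ (labelsN-base A) (trans (labelsN-++ (base B) R) (cong₂ _++_ (labelsN-base B) ih)) ⟩
  zeros A ++ zeros B ++ zeros (lower A) ++ order k (lower A) (lower B)
    ≡⟨ cong (zeros A ++_) (++-assoc (zeros B) _ _) ⟨
  zeros A ++ order (suc k) A B ∎
  where
  open ≡-Reasoning
  R  = bfs k (lower A) (lower B)
  ih = labelsN-order k (lower A) (lower B) (below-lower a)

labelsE-suffix : ∀ Y R → length (labelsE R) ≤ length (labelsE (Y ++ R))
labelsE-suffix []            R = ℕₚ.≤-refl
labelsE-suffix ((N , _) ∷ Y) R = labelsE-suffix Y R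
labelsE-suffix ((E , _) ∷ Y) R = ℕₚ.m≤n⇒m≤1+n (labelsE-suffix Y R)

labelsN-suffix : ∀ Y R → length (labelsN R) ≤ length (labelsN (Y ++ R))
labelsN-suffix []            R = ℕₚ.≤-refl
labelsN-suffix ((E , _) ∷ Y) R = labelsN-suffix Y R
labelsN-suffix ((N , _) ∷ Y) R = ℕₚ.m≤n⇒m≤1+n (labelsN-suffix Y R)

-- If the N's of `R` already pay for all E's of the whole word, then every suffix starting inside
-- `Y` is safe.
ballot-++ : ∀ Y R → length (labelsE (Y ++ R)) ≤ length (labelsN R) → Ballot R → Ballot (Y ++ R)
ballot-++ []      R _ b = b
ballot-++ (l ∷ Y) R e b =
    ℕₚ.≤-trans e (labelsN-suffix (l ∷ Y) R)
  , ballot-++ Y R (ℕₚ.≤-trans (labelsE-suffix (l ∷ []) (Y ++ R)) e) b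

bfs-ballot : ∀ k A B → Below k A → Below k B → Ballot (bfs k A B)
bfs-ballot zero    A B _ _ = tt
bfs-ballot (suc k) A B a b =
  subst Ballot (++-assoc (base A) (base B) R)
    (ballot-++ (base A ++ base B) R (ℕₚ.≤-reflexive (cong length eq)) (bfs-ballot k _ _ a′ b′))
  where
  open ≡-Reasoning
  R  = bfs k (lower A) (lower B)
  a′ = below-lower a
  b′ = below-lower b
  -- After the two lowest blocks, the N's are exactly the reappearances of all E's read so far or
  -- still to come.
  eq : labelsE ((base A ++ base B) ++ R) ≡ labelsN R
  eq = begin
    labelsE ((base A ++ base B) ++ R)
      ≡⟨ labelsE-++ (base A ++ base B) R ⟩
    labelsE (base A ++ base B) ++ labelsE R
      ≡⟨ cong (_++ labelsE R) (trans (labelsE-++ (base A) (base B)) (cong₂ _++_ (labelsE-base A) (labelsE-base B))) ⟩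
    (zeros (lower A) ++ zeros (lower B)) ++ labelsE R
      ≡⟨ ++-assoc (zeros (lower A)) _ _ ⟩
    zeros (lower A) ++ zeros (lower B) ++ labelsE R
      ≡⟨ labelsN-bfs k _ _ a′ b′ ⟨
    labelsN R ∎

-- Rebuilding a half from its lowest word and its lowered remainder

weave-N : ∀ {x} Y A → Head IsZero A → weave ((N , x) ∷ Y) A ≡ (0 , x) ∷ weave Y A
weave-N Y []              _    = refl
weave-N Y ((zero , _) ∷ _) _  = refl

-- Linkedness is what fixes the position of the high items: one standing right after a 0 would be
-- moved in front of it.
weave-base-lower : ∀ A → Linked _⊲_ A → weave (base A) (lower A) ≡ A
weave-base-lower []                      _ = refl
weave-base-lower ((zero        , x) ∷ A) l =
  trans (weave-N (base A) (lower A) (head-lower A l)) (cong ((0 , x) ∷_) (weave-base-lower A (Linked.tail l)))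
weave-base-lower ((suc zero    , x) ∷ A) l = cong ((1 , x) ∷_) (weave-base-lower A (Linked.tail l))
weave-base-lower ((suc (suc k) , x) ∷ A) l = cong ((suc (suc k) , x) ∷_) (weave-base-lower A (Linked.tail l))

base-weave : ∀ Y A → zeros A ≡ labelsE Y → base (weave Y A) ≡ Y
base-weave Y             ((suc k , x) ∷ A) e  = base-weave Y A e
base-weave []            []                e  = refl
base-weave ((N , x) ∷ Y) []                e  = cong ((N , x) ∷_) (base-weave Y [] e)
base-weave ((N , x) ∷ Y) ((zero , y) ∷ A)  e  = cong ((N , x) ∷_) (base-weave Y ((zero , y) ∷ A) e)
base-weave ((E , x) ∷ Y) ((zero , y) ∷ A)  e  =
  cong₂ (λ v → (E , v) ∷_) (∷-injectiveˡ e) (base-weave Y A (∷-injectiveʳ e))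

lower-weave : ∀ Y A → zeros A ≡ labelsE Y → lower (weave Y A) ≡ A
lower-weave Y             ((suc k , x) ∷ A) e  = cong ((suc k , x) ∷_) (lower-weave Y A e)
lower-weave []            []                e  = refl
lower-weave ((N , x) ∷ Y) []                e  = lower-weave Y [] e
lower-weave ((N , x) ∷ Y) ((zero , y) ∷ A)  e  = lower-weave Y (_ ∷ A) e
lower-weave ((E , x) ∷ Y) ((zero , y) ∷ A)  e  = cong ((zero , y) ∷_) (lower-weave Y A (∷-injectiveʳ e))

mutual
  -- The condition on a step from 0 to 1 comes from a factor NE of the word, that on a higher step
  -- from the remainder, shifted up by one. The index 0 or 1 tells whether the last item emitted was
  -- an N or a raised item of `A`.
  weave-linked₀ : ∀ {x} Y A → Linked Rise ((N , x) ∷ Y) → Dyck A → zeros A ≡ labelsE Y →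
    Linked _⊲_ ((0 , x) ∷ weave Y A)
  weave-linked₀ []            []               _       _       _ = [-]
  weave-linked₀ _             ((suc _ , _) ∷ _) _      (() , _) _
  weave-linked₀ ((N , _) ∷ Y) []               (_ ∷ r) d       e = (z≤n , λ ()) ∷ weave-linked₀ Y [] r d e
  weave-linked₀ ((N , _) ∷ Y) ((zero , y) ∷ A) (_ ∷ r) d       e = (z≤n , λ ()) ∷ weave-linked₀ Y _ r d e
  weave-linked₀ ((E , _) ∷ Y) ((zero , y) ∷ A) (s ∷ r) (_ , l) e =
    (ℕₚ.≤-refl , λ _ → subst (_ ℤ.<_) (sym (∷-injectiveˡ e)) s) ∷ weave-linked₁ Y A (Linked.tail r) l (∷-injectiveʳ e)

  weave-linked₁ : ∀ {k x} Y A → Linked Rise Y → Linked _⊲_ ((k , x) ∷ A) → zeros A ≡ labelsE Y →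
    Linked _⊲_ ((suc k , x) ∷ weave Y A)
  weave-linked₁ Y             ((suc _ , _) ∷ A) r ((s , t) ∷ l) e =
    (s≤s s , t ∘ ℕₚ.suc-injective) ∷ weave-linked₁ Y A r l e
  weave-linked₁ []            []                _ _             _ = [-]
  weave-linked₁ ((N , _) ∷ Y) []                r _             e = (z≤n , λ ()) ∷ weave-linked₀ Y [] r (tt , []) e
  weave-linked₁ ((N , _) ∷ Y) ((zero , _) ∷ A)  r (_ ∷ l)       e = (z≤n , λ ()) ∷ weave-linked₀ Y _ r (refl , l) e
  weave-linked₁ ((E , _) ∷ Y) ((zero , _) ∷ A)  r (_ ∷ l)       e =
    (s≤s z≤n , λ ()) ∷ weave-linked₁ Y A (Linked.tail r) l (∷-injectiveʳ e)

weave-dyck : ∀ Y A → Head IsN Y → Linked Rise Y → Dyck A → zeros A ≡ labelsE Y → Dyck (weave Y A)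
weave-dyck _              ((suc _ , _) ∷ _)  _    _ (() , _) _
weave-dyck []             []                 _    _ _ _ = tt , []
weave-dyck (.(N , _) ∷ Y) A@[]               refl r d e = refl , weave-linked₀ Y A r d e
weave-dyck (.(N , _) ∷ Y) A@((zero , _) ∷ _) refl r d e = refl , weave-linked₀ Y A r d e

weave-below : ∀ {k} Y A → Below k A → Below (suc k) (weave Y A)
weave-below Y             ((suc _ , _) ∷ A) (b ∷ bs) = s≤s b ∷ weave-below Y A bs
weave-below []            []                _        = []
weave-below []            ((zero , _) ∷ A)  _        = []
weave-below ((N , _) ∷ Y) []                b        = s≤s z≤n ∷ weave-below Y [] b
weave-below ((N , _) ∷ Y) ((zero , _) ∷ A)  b        = s≤s z≤n ∷ weave-below Y (_ ∷ A) b
weave-below ((E , _) ∷ Y) []                _        = []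
weave-below ((E , _) ∷ Y) ((zero , _) ∷ A)  (b ∷ bs) = s≤s b ∷ weave-below Y A bs

-- Cutting a code into blocks and decoding it

++-injective : ∀ {X : Set} (xs xs′ : List X) {ys ys′} → length xs ≡ length xs′ →
  xs ++ ys ≡ xs′ ++ ys′ → xs ≡ xs′ × ys ≡ ys′
++-injective []       []         _ e = refl , e
++-injective (x ∷ xs) (x′ ∷ xs′) l e with ++-injective xs xs′ (ℕₚ.suc-injective l) (∷-injectiveʳ e)
... | p , q = cong₂ _∷_ (∷-injectiveˡ e) p , q

-- A word starting with N, or empty, marks the end of the preceding block,
-- so the number of N's of that block determines it.
block-cancel : ∀ Y Y′ {R R′} → length (labelsN Y) ≡ length (labelsN Y′) →
  Head IsN R → Head IsN R′ → Y ++ R ≡ Y′ ++ R′ → Y ≡ Y′ × R ≡ R′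
block-cancel [] [] _ _ _ e = refl , e
block-cancel [] ((E , _) ∷ _) _ h _ refl with () ← h
block-cancel ((E , _) ∷ _) [] _ _ h refl with () ← h
block-cancel ((N , _) ∷ Y) ((N , _) ∷ Y′) l h h′ e
  with block-cancel Y Y′ (ℕₚ.suc-injective l) h h′ (∷-injectiveʳ e)
... | p , q = cong₂ _∷_ (∷-injectiveˡ e) p , q
block-cancel ((E , _) ∷ Y) ((E , _) ∷ Y′) l h h′ e
  with block-cancel Y Y′ l h h′ (∷-injectiveʳ e)
... | p , q = cong₂ _∷_ (∷-injectiveˡ e) p , q

bfs-injective : ∀ k {A B A′ B′} → Dyck A → Dyck B → Dyck A′ → Dyck B′ →
  Below k A → Below k B → Below k A′ → Below k B′ →
  length (zeros A) ≡ length (zeros A′) → length (zeros B) ≡ length (zeros B′) →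
  bfs k A B ≡ bfs k A′ B′ → A ≡ A′ × B ≡ B′
bfs-injective zero _ _ _ _ a b a′ b′ _ _ _ =
    trans (below-zero a) (sym (below-zero a′))
  , trans (below-zero b) (sym (below-zero b′))
bfs-injective (suc k) {A} {B} {A′} {B′} dA dB dA′ dB′ a b a′ b′ lA lB e =
    rebuild dA dA′ baseA (proj₁ ih) , rebuild dB dB′ baseB (proj₂ ih)
  where
  countN-base : ∀ {A A′} → length (zeros A) ≡ length (zeros A′) →
    length (labelsN (base A)) ≡ length (labelsN (base A′))
  countN-base {A} {A′} l = begin
    length (labelsN (base A))  ≡⟨ cong length (labelsN-base A) ⟩
    length (zeros A)           ≡⟨ l ⟩
    length (zeros A′)          ≡⟨ cong length (labelsN-base A′) ⟨
    length (labelsN (base A′)) ∎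
    where open ≡-Reasoning
  -- The E's of the block just identified fix the number of N's of the next block of the same half.
  zeros-lower : ∀ {A A′} → base A ≡ base A′ → length (zeros (lower A)) ≡ length (zeros (lower A′))
  zeros-lower {A} {A′} eq = cong length (begin
    zeros (lower A)   ≡⟨ labelsE-base A ⟨
    labelsE (base A)  ≡⟨ cong labelsE eq ⟩
    labelsE (base A′) ≡⟨ labelsE-base A′ ⟩
    zeros (lower A′)  ∎)
    where open ≡-Reasoning
  rebuild : ∀ {A A′} → Dyck A → Dyck A′ → base A ≡ base A′ → lower A ≡ lower A′ → A ≡ A′
  rebuild {A} {A′} (_ , l) (_ , l′) p q =
    trans (sym (weave-base-lower A l)) (trans (cong₂ weave p q) (weave-base-lower A′ l′))
  rest : ∀ {A B} → Dyck A → Dyck B → Head IsN (bfs k (lower A) (lower B))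
  rest dA dB = bfs-head k (lower-dyck dA) (lower-dyck dB)
  cut  = block-cancel (base A) (base A′) (countN-base {A} {A′} lA)
           (head-++ {xs = base B} (base-head dB) (rest dA dB))
           (head-++ {xs = base B′} (base-head dB′) (rest dA′ dB′)) e
  cut′ = block-cancel (base B) (base B′) (countN-base {B} {B′} lB) (rest dA dB) (rest dA′ dB′) (proj₂ cut)
  baseA = proj₁ cut
  baseB = proj₁ cut′
  ih = bfs-injective k (lower-dyck dA) (lower-dyck dB) (lower-dyck dA′) (lower-dyck dB′)
         (below-lower a) (below-lower b) (below-lower a′) (below-lower b′)
         (zeros-lower {A} {A′} baseA) (zeros-lower {B} {B′} baseB) (proj₂ cut′)

-- The cut is made immediately before N number p + 1, so that all E's following the p-th N stay in
-- the block.
split : ∀ p R → p ≤ length (labelsN R) →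
  Σ (List Letter) λ Y → Σ (List Letter) λ R′ → R ≡ Y ++ R′ × length (labelsN Y) ≡ p × Head IsN R′
split zero    []            _ = [] , [] , refl , refl , tt
split zero    ((N , x) ∷ R) _ = [] , (N , x) ∷ R , refl , refl , refl
split (suc p) ((N , x) ∷ R) l with split p R (ℕ.s≤s⁻¹ l)
... | Y , R′ , e , c , h = (N , x) ∷ Y , R′ , cong ((N , x) ∷_) e , cong suc c , h
split p       ((E , x) ∷ R) l with split p R l
... | Y , R′ , e , c , h = (E , x) ∷ Y , R′ , cong ((E , x) ∷_) e , c , h

head-++⁻ : ∀ {X : Set} {P : X → Set} (xs : List X) {ys} → Head P (xs ++ ys) → Head P xs
head-++⁻ []      _ = tt
head-++⁻ (_ ∷ _) p = p

ballot-++⁻ : ∀ Y {R} → Ballot (Y ++ R) → Ballot R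
ballot-++⁻ []      b       = b
ballot-++⁻ (_ ∷ Y) (_ , b) = ballot-++⁻ Y b

ballot-head : ∀ R → Ballot R → length (labelsE R) ≤ length (labelsN R)
ballot-head []      _       = z≤n
ballot-head (_ ∷ _) (p , _) = p

bfs-[] : ∀ k → bfs k [] [] ≡ []
bfs-[] zero    = refl
bfs-[] (suc k) = bfs-[] k

record Decoding (k : ℕ) (qA qB : List ℤ) (R : List Letter) : Set where
  field
    A B    : List Item
    dyckA  : Dyck A
    dyckB  : Dyck B
    belowA : Below k A
    belowB : Below k B
    zerosA : zeros A ≡ qA
    zerosB : zeros B ≡ qB
    code   : bfs k A B ≡ R

-- qA ++ qB is the queue of the vertices whose children are still to be read.
decode : ∀ k qA qB R → Head IsN R → Linked Rise R → Ballot R →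
  labelsN R ≡ qA ++ qB ++ labelsE R → R ≡ [] ⊎ length (labelsE R) ℕ.< k → Decoding k qA qB R
decode k [] [] [] _ _ _ _ _ = record
  { dyckA = tt , [] ; dyckB = tt , [] ; belowA = [] ; belowB = []
  ; zerosA = refl ; zerosB = refl ; code = bfs-[] k }
-- The measure is the number of unread E's: a round that leaves a nonempty rest lowers it, so fewer
-- than `k` unread E's need at most `k` levels.
decode (suc k) qA qB R@(_ ∷ _) h r b e (inj₂ f)
  with split (length qA) R (subst (λ v → length qA ≤ length v) (sym e)
         (subst (length qA ≤_) (sym (length-++ qA)) (ℕₚ.m≤m+n _ _)))
... | Y , R₁ , eY , cY , h₁
  with ++-injective (labelsN Y) qA cY (trans (sym (trans (cong labelsN eY) (labelsN-++ Y R₁))) e)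
... | nY , e₁
  with split (length qB) R₁ (subst (λ v → length qB ≤ length v) (sym e₁)
         (subst (length qB ≤_) (sym (length-++ qB)) (ℕₚ.m≤m+n _ _)))
... | Z , R₂ , refl , cZ , h₂
  with ++-injective (labelsN Z) qB cZ (trans (sym (labelsN-++ Z R₂)) e₁)
... | nZ , e₂ = record
  { A = weave Y (A ih) ; B = weave Z (B ih)
  ; dyckA = weave-dyck Y (A ih) (head-++⁻ Y (subst (Head IsN) eY h)) (linked-++⁻ˡ Y r₁) (dyckA ih) (zerosA ih)
  ; dyckB = weave-dyck Z (B ih) (head-++⁻ Z h₁) (linked-++⁻ˡ Z r₂) (dyckB ih) (zerosB ih)
  ; belowA = weave-below Y (A ih) (belowA ih)
  ; belowB = weave-below Z (B ih) (belowB ih)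
  ; zerosA = trans (sym (labelsN-base (weave Y (A ih)))) (trans (cong labelsN (base-weave Y (A ih) (zerosA ih))) nY)
  ; zerosB = trans (sym (labelsN-base (weave Z (B ih)))) (trans (cong labelsN (base-weave Z (B ih) (zerosB ih))) nZ)
  ; code = trans (cong₂ _++_ (base-weave Y (A ih) (zerosA ih)) (cong₂ _++_ (base-weave Z (B ih) (zerosB ih))
             (trans (cong₂ (bfs k) (lower-weave Y (A ih) (zerosA ih)) (lower-weave Z (B ih) (zerosB ih))) (code ih))))
             (sym eY)
  }
  where
  open Decoding
  r₁ = subst (Linked Rise) eY r
  r₂ = linked-++⁻ʳ Y r₁
  eE : labelsE R ≡ labelsE Y ++ labelsE Z ++ labelsE R₂
  eE = trans (cong labelsE eY) (trans (labelsE-++ Y _) (cong (labelsE Y ++_) (labelsE-++ Z R₂)))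
  queue : labelsN R₂ ≡ labelsE Y ++ labelsE Z ++ labelsE R₂
  queue = trans e₂ eE
  b₂ : Ballot R₂
  b₂ = ballot-++⁻ Z (ballot-++⁻ Y (subst Ballot eY b))
  -- Were the queue empty before a nonempty rest, deleting the leading N of the rest would violate the ballot condition.
  fuel : ∀ R₂ → Head IsN R₂ → Ballot R₂ → labelsN R₂ ≡ labelsE R → R₂ ≡ [] ⊎ length (labelsE R₂) ℕ.< k
  fuel []            _    _       _  = inj₁ refl
  fuel ((N , _) ∷ R₃) refl (_ , b) eq =
    inj₂ (ℕₚ.≤-trans (s≤s (ballot-head R₃ b)) (subst (ℕ._≤ k) (sym (cong length eq)) (ℕ.s≤s⁻¹ f)))
  ih = decode k (labelsE Y) (labelsE Z) R₂ h₂ (linked-++⁻ʳ Z r₂) b₂ queue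
         (fuel R₂ h₂ b₂ e₂)

-- Splitting a sequence of integer levels at zero

Point : Set
Point = ℤ × ℤ

infix 4 _◁_ _▷_

_◁_ : Point → Point → Set
(d , x) ◁ (e , y) = e ℤ.≤ ℤ.suc d × (e ≡ ℤ.suc d → x ℤ.< y)

_▷_ : Item → Item → Set
p ▷ q = q ⊲ p

NonNeg : Point → Set
NonNeg (d , _) = + 0 ℤ.≤ d

-- A point of level 0 goes into both halves, with opposite labels; these shared zeros are the marks
-- at which the halves are glued together again.
pos₁ neg₁ : Point → List Item
pos₁ (+ k      , x) = (k , x) ∷ []
pos₁ (-[1+ _ ] , _) = []
neg₁ (+ zero   , x) = (0 , - x) ∷ []
neg₁ (+ suc _  , _) = []
neg₁ (-[1+ k ] , x) = (suc k , - x) ∷ []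

pos neg : List Point → List Item
pos = concatMap pos₁
neg = concatMap neg₁

-- Between two consecutive zeros the positive levels precede the negative ones, because a climb from
-- below must pass through 0. Hence positive items are emitted first, then negative ones, then a
-- zero common to both lists; a zero left without partner ends the output by default.
join : List Item → List Item → List Point
join ((suc k , x) ∷ A)  C                  = (+ suc k , x) ∷ join A C
join []                 []                 = []
join []                 ((zero  , _) ∷ _)  = []
join []                 ((suc k , y) ∷ C)  = (-[1+ k ] , - y) ∷ join [] C
join ((zero , _) ∷ _)   []                 = []
join ((zero , x) ∷ A)   ((zero  , _) ∷ C)  = (+ 0 , x) ∷ join A C
join ((zero , x) ∷ A)   ((suc k , y) ∷ C)  = (-[1+ k ] , - y) ∷ join ((zero , x) ∷ A) C

zeros-neg : ∀ s → zeros (neg s) ≡ map -_ (zeros (pos s))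
zeros-neg []                   = refl
zeros-neg ((+ zero   , x) ∷ s) = cong (- x ∷_) (zeros-neg s)
zeros-neg ((+ suc _  , _) ∷ s) = zeros-neg s
zeros-neg ((-[1+ _ ] , _) ∷ s) = zeros-neg s

pos-join : ∀ A C → zeros C ≡ map -_ (zeros A) → pos (join A C) ≡ A
pos-join ((suc k , x) ∷ A) C                 e = cong ((suc k , x) ∷_) (pos-join A C e)
pos-join []                []                e = refl
pos-join []                ((suc _ , _) ∷ C) e = pos-join [] C e
pos-join ((zero , x) ∷ A)  ((zero  , _) ∷ C) e = cong ((0 , x) ∷_) (pos-join A C (∷-injectiveʳ e))
pos-join ((zero , x) ∷ A)  ((suc _ , _) ∷ C) e = pos-join ((zero , x) ∷ A) C e

neg-join : ∀ A C → zeros C ≡ map -_ (zeros A) → neg (join A C) ≡ C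
neg-join ((suc k , x) ∷ A) C                 e = neg-join A C e
neg-join []                []                e = refl
neg-join []                ((suc k , y) ∷ C) e =
  cong₂ (λ v → (suc k , v) ∷_) (ℤₚ.neg-involutive y) (neg-join [] C e)
neg-join ((zero , x) ∷ A)  ((zero  , _) ∷ C) e =
  cong₂ (λ v → (0 , v) ∷_) (sym (∷-injectiveˡ e)) (neg-join A C (∷-injectiveʳ e))
neg-join ((zero , x) ∷ A)  ((suc k , y) ∷ C) e =
  cong₂ (λ v → (suc k , v) ∷_) (ℤₚ.neg-involutive y) (neg-join ((zero , x) ∷ A) C e)

-- Each step increases the level by at most one, so 0 is visited between a negative and a positive level.
head-pos : ∀ {k x} s → Linked _◁_ ((-[1+ k ] , x) ∷ s) → Head IsZero (pos s)
head-pos []                    _                        = tt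
head-pos ((+ zero   , _) ∷ _)  _                        = refl
head-pos {zero}  ((+ suc _ , _) ∷ _) ((+≤+ () , _) ∷ _)
head-pos {suc _} ((+ suc _ , _) ∷ _) ((() , _) ∷ _)
head-pos ((-[1+ _ ] , _) ∷ s)  (_ ∷ l)                  = head-pos s l

mutual
  pos-linked : ∀ s → Linked _◁_ s → Linked _⊲_ (pos s)
  pos-linked []                   _ = []
  pos-linked ((+ _      , _) ∷ s) l = pos-linked₀ s l
  pos-linked ((-[1+ _ ] , _) ∷ s) l = pos-linked s (Linked.tail l)

  -- Deleting a run of negative levels does no harm, since the nonnegative part resumes at 0 and a
  -- step to 0 is always allowed.
  pos-linked₀ : ∀ {k x} s → Linked _◁_ ((+ k , x) ∷ s) → Linked _⊲_ ((k , x) ∷ pos s)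
  pos-linked₀ []                   _                   = [-]
  pos-linked₀ ((+ _ , _) ∷ s)      ((+≤+ r , t) ∷ l)   = (r , t ∘ cong +_) ∷ pos-linked₀ s l
  pos-linked₀ ((-[1+ _ ] , _) ∷ s) (_ ∷ l)             = ∷-zero (head-pos s l) (pos-linked s (Linked.tail l))

join-pos-neg : ∀ s → Linked _◁_ s → join (pos s) (neg s) ≡ s
join-pos-neg []                   _ = refl
join-pos-neg ((+ zero   , x) ∷ s) l = cong ((+ 0 , x) ∷_) (join-pos-neg s (Linked.tail l))
join-pos-neg ((+ suc k  , x) ∷ s) l = cong ((+ suc k , x) ∷_) (join-pos-neg s (Linked.tail l))
join-pos-neg ((-[1+ k ] , x) ∷ s) l =
  trans (emit (pos s) (head-pos s l))
        (cong₂ (λ v → (-[1+ k ] , v) ∷_) (ℤₚ.neg-involutive x) (join-pos-neg s (Linked.tail l)))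
  where
  -- With a zero next in the nonnegative half, no positive item can jump ahead of the negative one.
  emit : ∀ A {y C} → Head IsZero A → join A ((suc k , y) ∷ C) ≡ (-[1+ k ] , - y) ∷ join A C
  emit []               _ = refl
  emit ((zero , _) ∷ _) _ = refl

CoDyck : List Item → Set
CoDyck C = Linked _▷_ C × Last IsZero C

last-∷ : ∀ {X : Set} {P : X → Set} {x} (xs : List X) → P x → Last P xs → Last P (x ∷ xs)
last-∷ []      p _ = p
last-∷ (_ ∷ _) _ q = q

last-tail : ∀ {X : Set} {P : X → Set} {x} (xs : List X) → Last P (x ∷ xs) → Last P xs
last-tail []      _ = tt
last-tail (_ ∷ _) q = q

∷-zero▷ : ∀ {x} C → CoDyck C → CoDyck ((0 , x) ∷ C)
∷-zero▷ []      _       = [-] , refl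
∷-zero▷ (_ ∷ _) (l , z) = (z≤n , λ ()) ∷ l , z

mutual
  -- Negating levels and labels turns the relation around, so this half is a Dyck sequence only when
  -- read from its end. Its last item is a zero because the sequence must come back to 0 after its
  -- last negative level.
  neg-codyck : ∀ s → Linked _◁_ s → Last NonNeg s → CoDyck (neg s)
  neg-codyck []                   _ _ = [] , tt
  neg-codyck ((+ zero   , _) ∷ s) l p = ∷-zero▷ (neg s) (neg-codyck s (Linked.tail l) (last-tail s p))
  neg-codyck ((+ suc _  , _) ∷ s) l p = neg-codyck s (Linked.tail l) (last-tail s p)
  neg-codyck ((-[1+ _ ] , _) ∷ s) l p = neg-codyck₁ s l p

  neg-codyck₁ : ∀ {k x} s → Linked _◁_ ((-[1+ k ] , x) ∷ s) → Last NonNeg ((-[1+ k ] , x) ∷ s) →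
    CoDyck ((suc k , - x) ∷ neg s)
  neg-codyck₁ {zero}  ((+ zero  , _) ∷ s) ((_ , t) ∷ l) p
    with neg-codyck ((+ zero  , _) ∷ s) l p
  ... | l′ , z = (s≤s z≤n , λ _ → ℤₚ.neg-mono-< (t refl)) ∷ l′ , z
  neg-codyck₁ {suc _} ((+ zero  , _) ∷ s) ((() , _) ∷ _)
  neg-codyck₁ {zero}  ((+ suc _ , _) ∷ s) ((+≤+ () , _) ∷ _)
  neg-codyck₁ {suc _} ((+ suc _ , _) ∷ s) ((() , _) ∷ _)
  neg-codyck₁ {zero}  ((-[1+ _ ] , _) ∷ s) (_ ∷ l) p with neg-codyck₁ s l p
  ... | l′ , z = (s≤s z≤n , λ ()) ∷ l′ , z
  neg-codyck₁ {suc k} ((-[1+ m ] , _) ∷ s) ((-≤- r , t) ∷ l) p with neg-codyck₁ s l p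
  ... | l′ , z = (s≤s (s≤s r) , λ { refl → ℤₚ.neg-mono-< (t refl) }) ∷ l′ , z

Good : List Point → Set
Good s = Linked _◁_ s × Last NonNeg s

mutual
  join-good₊ : ∀ {k x} A C → Linked _⊲_ ((k , x) ∷ A) → CoDyck C → zeros C ≡ map -_ (zeros A) →
    Good ((+ k , x) ∷ join A C)
  join-good₊ ((suc m , _) ∷ A) C (( r , t) ∷ l) c e with join-good₊ A C l c e
  ... | l′ , p = (+≤+ r , t ∘ ℤₚ.+-injective) ∷ l′ , p
  join-good₊ [] [] _ _ _ = [-] , +≤+ z≤n
  join-good₊ [] ((suc _ , _) ∷ C) _ c e with join-good₋ [] C tt [] c e
  ... | l′ , p = (-≤+ , λ ()) ∷ l′ , p
  join-good₊ ((zero , _) ∷ A) ((suc _ , _) ∷ C) (_ ∷ l) c e with join-good₋ (_ ∷ A) C refl l c e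
  ... | l′ , p = (-≤+ , λ ()) ∷ l′ , p
  join-good₊ ((zero , _) ∷ A) ((zero , _) ∷ C) (_ ∷ l) (lc , z) e
    with join-good₊ A C l (Linked.tail lc , last-tail C z) (∷-injectiveʳ e)
  ... | l′ , p = (+≤+ z≤n , λ ()) ∷ l′ , p

  join-good₋ : ∀ {k y} A C → Head IsZero A → Linked _⊲_ A → CoDyck ((suc k , y) ∷ C) →
    zeros C ≡ map -_ (zeros A) → Good ((-[1+ k ] , - y) ∷ join A C)
  join-good₋ [] ((suc m , _) ∷ C) h l (r ∷ lc , z) e with join-good₋ [] C h l (lc , z) e
  ... | l′ , p = ◁-neg r ∷ l′ , p
  join-good₋ ((zero , _) ∷ A) ((suc m , _) ∷ C) h l (r ∷ lc , z) e with join-good₋ (_ ∷ A) C h l (lc , z) e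
  ... | l′ , p = ◁-neg r ∷ l′ , p
  join-good₋ {k} {y} ((zero , x) ∷ A) ((zero , y′) ∷ C) h l ((s≤s z≤n , t) ∷ lc , z) e
    with join-good₊ A C l (Linked.tail lc , last-tail C z) (∷-injectiveʳ e)
  ... | l′ , p = (+≤+ z≤n , λ _ → subst (- y ℤ.<_) eq (ℤₚ.neg-mono-< (t refl))) ∷ l′ , p
    where
    -- The heads of `A` and `C` are the two records of one zero, so the comparison made with `y′` in
    -- the lower half applies to `x`.
    eq : - y′ ≡ x
    eq = trans (cong -_ (∷-injectiveˡ e)) (ℤₚ.neg-involutive x)

  ◁-neg : ∀ {k m y y′} → (suc k , y) ▷ (suc m , y′) → (-[1+ k ] , - y) ◁ (-[1+ m ] , - y′)
  ◁-neg {zero}  (_ , t)       = -≤+ , λ ()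
  ◁-neg {suc k} (s≤s (s≤s r) , t) = -≤- r , λ { refl → ℤₚ.neg-mono-< (t refl) }

linked-ʳ++ : ∀ {X : Set} {S : X → X → Set} {x} xs {ys} →
  Linked S (x ∷ xs) → Linked (flip S) (x ∷ ys) → Linked (flip S) (xs ʳ++ (x ∷ ys))
linked-ʳ++ []       _       m = m
linked-ʳ++ (_ ∷ xs) (s ∷ l) m = linked-ʳ++ xs l (s ∷ m)

linked-reverse : ∀ {X : Set} {S : X → X → Set} xs → Linked S xs → Linked (flip S) (reverse xs)
linked-reverse []       _ = []
linked-reverse (_ ∷ xs) l = linked-ʳ++ xs l [-]

head-ʳ++ : ∀ {X : Set} {P : X → Set} {x} xs {ys} → Last P (x ∷ xs) → Head P (xs ʳ++ (x ∷ ys))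
head-ʳ++ []       p = p
head-ʳ++ (_ ∷ xs) p = head-ʳ++ xs p

head-reverse : ∀ {X : Set} {P : X → Set} xs → Last P xs → Head P (reverse xs)
head-reverse []       _ = tt
head-reverse (_ ∷ xs) p = head-ʳ++ xs p

last-ʳ++ : ∀ {X : Set} {P : X → Set} {y} xs {ys} → Last P (y ∷ ys) → Last P (xs ʳ++ (y ∷ ys))
last-ʳ++ []       p = p
last-ʳ++ (_ ∷ xs) p = last-ʳ++ xs p

last-reverse : ∀ {X : Set} {P : X → Set} xs → Head P xs → Last P (reverse xs)
last-reverse []       _ = tt
last-reverse (_ ∷ xs) p = last-ʳ++ xs p

dyck-reverse : ∀ C → CoDyck C → Dyck (reverse C)
dyck-reverse C (l , z) = head-reverse C z , linked-reverse C l

codyck-reverse : ∀ B → Dyck B → CoDyck (reverse B)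
codyck-reverse B (h , l) = linked-reverse B l , last-reverse B h

-- Lattice paths and the heights after their North steps

heights : ℤ → List Step → List ℤ
heights c []      = []
heights c (N ∷ π) = ℤ.suc c ∷ heights (ℤ.suc c) π
heights c (E ∷ π) = heights (ℤ.pred c) π

points : (ℕ → ℤ) → ℤ → ℕ → List Step → List Point
points f c k []      = []
points f c k (N ∷ π) = (ℤ.suc c , f (suc k)) ∷ points f (ℤ.suc c) (suc k) π
points f c k (E ∷ π) = points f (ℤ.pred c) k π

levels-points : ∀ f c k π → map proj₁ (points f c k π) ≡ heights c π
levels-points f c k []      = refl
levels-points f c k (N ∷ π) = cong (ℤ.suc c ∷_) (levels-points f _ _ π)
levels-points f c k (E ∷ π) = levels-points f _ _ π

applyUpTo-cong : ∀ {X : Set} {f g : ℕ → X} n → (∀ {t} → t ℕ.< n → f t ≡ g t) → applyUpTo f n ≡ applyUpTo g n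
applyUpTo-cong zero    _ = refl
applyUpTo-cong (suc n) e = cong₂ _∷_ (e (s≤s z≤n)) (applyUpTo-cong n (e ∘ s≤s))

applyUpTo-shift : ∀ {X : Set} (f : ℕ → X) k n →
  applyUpTo (λ t → f (k ℕ.+ t)) (suc n) ≡ f k ∷ applyUpTo (λ t → f (suc k ℕ.+ t)) n
applyUpTo-shift f k n =
  cong₂ _∷_ (cong f (ℕₚ.+-identityʳ k)) (applyUpTo-cong n (λ {t} _ → cong f (ℕₚ.+-suc k t)))

applyUpTo-++ : ∀ {X : Set} (f : ℕ → X) m n →
  applyUpTo f (m ℕ.+ n) ≡ applyUpTo f m ++ applyUpTo (λ t → f (m ℕ.+ t)) n
applyUpTo-++ f zero    n = refl
applyUpTo-++ f (suc m) n = cong (f 0 ∷_) (applyUpTo-++ (f ∘ suc) m n)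

applyDownFrom-∸ : ∀ {X : Set} (f : ℕ → X) n → applyDownFrom f n ≡ applyUpTo (λ t → f (n ∸ suc t)) n
applyDownFrom-∸ f zero    = refl
applyDownFrom-∸ f (suc n) = cong (f n ∷_) (applyDownFrom-∸ f n)

labels-points : ∀ f c k π → map proj₂ (points f c k π) ≡ applyUpTo (λ t → f (suc (k ℕ.+ t))) (countN π)
labels-points f c k []      = refl
labels-points f c k (N ∷ π) =
  trans (cong (f (suc k) ∷_) (labels-points f _ (suc k) π)) (sym (applyUpTo-shift (f ∘ suc) k (countN π)))
labels-points f c k (E ∷ π) = labels-points f _ k π

length-points : ∀ f c k π → length (points f c k π) ≡ countN π
length-points f c k π = trans (sym (length-map proj₂ (points f c k π)))
  (trans (cong length (labels-points f c k π)) (length-applyUpTo _ (countN π)))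

heights-lam : ∀ k e π → heights (+ k ℤ.- + e) π ≡
  applyUpTo (λ t → + suc (k ℕ.+ t) ℤ.- + atℕ (lamFrom e π) (suc t)) (countN π)
heights-lam k e []      = refl
heights-lam k e (N ∷ π) = cong₂ _∷_ (trans eq (cong (λ v → + suc v ℤ.- + e) (sym (ℕₚ.+-identityʳ k))))
  (trans (cong (λ c → heights c π) eq) (trans (heights-lam (suc k) e π)
    (applyUpTo-cong (countN π) (λ {t} _ → cong (λ v → + suc v ℤ.- + atℕ (lamFrom e π) (suc t)) (sym (ℕₚ.+-suc k t))))))
  where
  eq : ℤ.suc (+ k ℤ.- + e) ≡ + suc k ℤ.- + e
  eq = sym (ℤₚ.+-assoc (+ 1) (+ k) (- + e))
heights-lam k e (E ∷ π) = trans (cong (λ c → heights c π) eq) (heights-lam k (suc e) π)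
  where
  eq : ℤ.pred (+ k ℤ.- + e) ≡ + k ℤ.- + suc e
  eq = trans (ℤₚ.+-comm -[1+ 0 ] (+ k ℤ.- + e)) (trans (ℤₚ.+-assoc (+ k) (- + e) -[1+ 0 ])
    (cong (λ v → + k ℤ.+ v) (trans (ℤₚ.+-comm (- + e) -[1+ 0 ]) (sym (ℤₚ.neg-distrib-+ (+ 1) (+ e))))))

at-applyUpTo : ∀ u → applyUpTo (at u ∘ suc) (length u) ≡ u
at-applyUpTo []      = refl
at-applyUpTo (x ∷ u) = cong (x ∷_) (at-applyUpTo u)

-- Two reversals of the index cancel: entry n + 1 - j of μ is j - λ(j), the height just after the
-- j-th N.
heights-mu : ∀ n π → countN π ≡ n → map (λ j → mu n π (suc n ∸ j)) (oneTo n) ≡ heights (+ 0) π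
heights-mu n π refl = begin
  map (λ j → mu n π (suc n ∸ j)) (map suc (upTo n)) ≡⟨ map-∘ (upTo n) ⟨
  map (λ t → mu n π (n ∸ t)) (upTo n)               ≡⟨ map-upTo _ n ⟩
  applyUpTo (λ t → mu n π (n ∸ t)) n                ≡⟨ applyUpTo-cong n (λ l → cong (λ v → + v ℤ.- + atℕ (lam π) v) (index l)) ⟩
  applyUpTo (λ t → + suc t ℤ.- + atℕ (lam π) (suc t)) n ≡⟨ heights-lam 0 0 π ⟨
  heights (+ 0) π                                   ∎
  where
  open ≡-Reasoning
  index : ∀ {t} → t ℕ.< n → suc n ∸ (n ∸ t) ≡ suc t
  index {t} l = trans (ℕₚ.+-∸-assoc 1 (ℕₚ.m∸n≤m n t)) (cong suc (ℕₚ.m∸[m∸n]≡n (ℕₚ.<⇒≤ l)))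

reverse-oneTo : ∀ n → reverse (oneTo n) ≡ map (suc n ∸_) (oneTo n)
reverse-oneTo n = begin
  reverse (map suc (upTo n))        ≡⟨ cong reverse (map-upTo suc n) ⟩
  reverse (applyUpTo suc n)         ≡⟨ reverse-applyUpTo suc n ⟩
  applyDownFrom suc n               ≡⟨ applyDownFrom-∸ suc n ⟩
  applyUpTo (λ t → suc (n ∸ suc t)) n ≡⟨ applyUpTo-cong n (λ l → sym (ℕₚ.+-∸-assoc 1 l)) ⟩
  applyUpTo (λ t → n ∸ t) n         ≡⟨ map-upTo _ n ⟨
  map (λ t → n ∸ t) (upTo n)        ≡⟨ map-∘ (upTo n) ⟩
  map (suc n ∸_) (oneTo n)          ∎
  where open ≡-Reasoning

reverse-muList : ∀ n π → countN π ≡ n → reverse (muList n π) ≡ heights (+ 0) π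
reverse-muList n π e = begin
  reverse (map (mu n π) (oneTo n))        ≡⟨ reverse-map (mu n π) (oneTo n) ⟨
  map (mu n π) (reverse (oneTo n))        ≡⟨ cong (map (mu n π)) (reverse-oneTo n) ⟩
  map (mu n π) (map (suc n ∸_) (oneTo n)) ≡⟨ map-∘ (oneTo n) ⟨
  map (λ j → mu n π (suc n ∸ j)) (oneTo n) ≡⟨ heights-mu n π e ⟩
  heights (+ 0) π                         ∎
  where open ≡-Reasoning

list-ext : ∀ {X Y : Set} {xs ys : List (X × Y)} → map proj₁ xs ≡ map proj₁ ys → map proj₂ xs ≡ map proj₂ ys → xs ≡ ys
list-ext {xs = []}    {[]}    _ _ = refl
list-ext {xs = _ ∷ _} {_ ∷ _} p q =
  cong₂ _∷_ (cong₂ _,_ (∷-injectiveˡ p) (∷-injectiveˡ q)) (list-ext (∷-injectiveʳ p) (∷-injectiveʳ q))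

points-mu : ∀ n π u → countN π ≡ n → map (λ j → mu n π (suc n ∸ j) , at u j) (oneTo n) ≡ points (at u) (+ 0) 0 π
points-mu n π u refl = list-ext
  (trans (sym (map-∘ (oneTo n))) (trans (heights-mu n π refl) (sym (levels-points (at u) _ 0 π))))
  (begin
    map proj₂ (map (λ j → mu n π (suc n ∸ j) , at u j) (oneTo n)) ≡⟨ map-∘ (oneTo n) ⟨
    map (at u) (map suc (upTo n))                                ≡⟨ map-∘ (upTo n) ⟨
    map (at u ∘ suc) (upTo n)                                    ≡⟨ map-upTo _ n ⟩
    applyUpTo (at u ∘ suc) n                                     ≡⟨ labels-points (at u) _ 0 π ⟨
    map proj₂ (points (at u) (+ 0) 0 π)                          ∎)
  where open ≡-Reasoning

height-bound : ∀ c π {d ds} → heights c π ≡ d ∷ ds → d ℤ.≤ ℤ.suc c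
height-bound c (N ∷ π) refl = ℤₚ.≤-refl
height-bound c (E ∷ π) e    =
  ℤₚ.≤-trans (height-bound (ℤ.pred c) π e) (ℤₚ.suc-mono {ℤ.pred c} {c} (ℤₚ.i≤j⇒pred[i]≤j {c} ℤₚ.≤-refl))

suc≰suc-pred : ∀ c {X : Set} → ℤ.suc c ℤ.≤ ℤ.suc (ℤ.pred c) → X
suc≰suc-pred c p = contradiction (ℤₚ.suc[i]≤j⇒i<j (subst (ℤ.suc c ℤ.≤_) (ℤₚ.suc-pred c) p)) (ℤₚ.<-irrefl refl)

-- An N at height c records c + 1, whereas after an E the next recorded height is at most c. Only
-- the final run of E's leaves no trace, and the total number of E's restores it.
heights-injective : ∀ c π π′ → countE π ≡ countE π′ → heights c π ≡ heights c π′ → π ≡ π′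
heights-injective c []      []       _ _ = refl
heights-injective c []      (E ∷ π′) () _
heights-injective c (E ∷ π) []       () _
heights-injective c (N ∷ π) (N ∷ π′) p e = cong (N ∷_) (heights-injective _ π π′ p (∷-injectiveʳ e))
heights-injective c (E ∷ π) (E ∷ π′) p e = cong (E ∷_) (heights-injective _ π π′ (ℕₚ.suc-injective p) e)
heights-injective c (N ∷ π) (E ∷ π′) p e = suc≰suc-pred c (height-bound (ℤ.pred c) π′ (sym e))
heights-injective c (E ∷ π) (N ∷ π′) p e = suc≰suc-pred c (height-bound (ℤ.pred c) π e)

rises-N⁻ : ∀ {P : ℕ → Set} k π → (∀ i → i ∈ risesFrom k (N ∷ π) → P i) →
  (startsWithN π → P (suc k)) × (∀ i → i ∈ risesFrom (suc k) π → P i)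
rises-N⁻ k []      p = (λ ()) , (λ _ ())
rises-N⁻ k (N ∷ π) p = (λ _ → p _ (here refl)) , (λ i → p i ∘ there)
rises-N⁻ k (E ∷ π) p = (λ ()) , p

mutual
  -- The recorded height grows by exactly one precisely when two N's are adjacent; an E in between
  -- makes the label condition vacuous. For k = 0 the condition on an initial N takes the place of a
  -- rise numbered 0.
  rises⇒linked : ∀ f {c} k π → (startsWithN π → f k ℤ.< f (suc k)) →
    (∀ i → i ∈ risesFrom k π → f i ℤ.< f (suc i)) → Linked _◁_ ((c , f k) ∷ points f c k π)
  rises⇒linked f k []      _ _ = [-]
  rises⇒linked f k (N ∷ π) s r with rises-N⁻ k π r
  ... | s′ , r′ = (ℤₚ.≤-refl , λ _ → s tt) ∷ rises⇒linked f (suc k) π s′ r′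
  rises⇒linked f {c} k (E ∷ π) _ r = rises⇒linked₁ f {ℤ.pred c} k π (ℤₚ.i≤pred[j]⇒i<j {ℤ.pred c} {c} ℤₚ.≤-refl) r

  rises⇒linked₁ : ∀ f {c c₀ x} k π → c ℤ.< c₀ →
    (∀ i → i ∈ risesFrom k π → f i ℤ.< f (suc i)) → Linked _◁_ ((c₀ , x) ∷ points f c k π)
  rises⇒linked₁ f k []      _ _ = [-]
  rises⇒linked₁ f {c} {c₀} k (N ∷ π) l r with rises-N⁻ k π r
  ... | s′ , r′ =
      (ℤₚ.suc-mono (ℤₚ.<⇒≤ l) , λ e → contradiction l (ℤₚ.<-irrefl (suc-injective {c} {c₀} e)))
    ∷ rises⇒linked f (suc k) π s′ r′
    where
    suc-injective : ∀ {i j : ℤ} → ℤ.suc i ≡ ℤ.suc j → i ≡ j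
    suc-injective {i} {j} e = trans (sym (ℤₚ.pred-suc i)) (trans (cong ℤ.pred e) (ℤₚ.pred-suc j))
  rises⇒linked₁ f {c} k (E ∷ π) l r =
    rises⇒linked₁ f {ℤ.pred c} k π (ℤₚ.≤-<-trans (ℤₚ.i≤j⇒pred[i]≤j {c} ℤₚ.≤-refl) l) r

linked⇒rises : ∀ f c k π → Linked _◁_ (points f c k π) → ∀ i → i ∈ risesFrom k π → f i ℤ.< f (suc i)
linked⇒rises f c k (N ∷ N ∷ π) ((_ , t) ∷ _) i (here refl) = t refl
linked⇒rises f c k (N ∷ N ∷ π) (_ ∷ l)       i (there m)   = linked⇒rises f (ℤ.suc c) (suc k) (N ∷ π) l i m
linked⇒rises f c k (N ∷ E ∷ π) l             i m           = linked⇒rises f (ℤ.suc c) (suc k) (E ∷ π) (Linked.tail l) i m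
linked⇒rises f c k (E ∷ π)     l             i m           = linked⇒rises f (ℤ.pred c) k π l i m

-- The equation says that the rest of the path leads from height `c` to 0. Only E's separate the
-- last recorded level `c₀` from the current height, so at the end 0 ≤ `c₀`.
points-last : ∀ f c c₀ {x} k π → c ℤ.≤ c₀ → c ℤ.+ + countN π ≡ + countE π →
  Last NonNeg ((c₀ , x) ∷ points f c k π)
points-last f c c₀ k []      l e = subst (ℤ._≤ c₀) (trans (sym (ℤₚ.+-identityʳ c)) e) l
points-last f c c₀ k (N ∷ π) l e = points-last f (ℤ.suc c) (ℤ.suc c) (suc k) π ℤₚ.≤-refl
  (trans (trans (cong (ℤ._+ + countN π) (ℤₚ.+-comm (+ 1) c)) (ℤₚ.+-assoc c (+ 1) (+ countN π))) e)
points-last f c c₀ k (E ∷ π) l e = points-last f (ℤ.pred c) c₀ k π (ℤₚ.≤-trans (ℤₚ.i≤j⇒pred[i]≤j ℤₚ.≤-refl) l)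
  (trans (ℤₚ.pred-+ c (+ countN π)) (cong ℤ.pred e))

descend : ∀ {i j} → i ℤ.≤ j → ∃ λ m → j ≡ i ℤ.+ + m
descend {i} {j} p = ∣ j ℤ.- i ∣ , (begin
  j                       ≡⟨ ℤₚ.+-identityʳ j ⟨
  j ℤ.+ + 0               ≡⟨ cong (λ v → j ℤ.+ v) (ℤₚ.+-inverseˡ i) ⟨
  j ℤ.+ (- i ℤ.+ i)       ≡⟨ ℤₚ.+-assoc j (- i) i ⟨
  (j ℤ.- i) ℤ.+ i         ≡⟨ ℤₚ.+-comm _ i ⟩
  i ℤ.+ (j ℤ.- i)         ≡⟨ cong (λ v → i ℤ.+ v) (ℤₚ.0≤i⇒+∣i∣≡i (ℤₚ.i≤j⇒0≤j-i p)) ⟨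
  i ℤ.+ + ∣ j ℤ.- i ∣     ∎)
  where open ≡-Reasoning

heights-descend : ∀ m c π → heights (c ℤ.+ + m) (replicate m E ++ π) ≡ heights c π
heights-descend zero    c π = cong (λ d → heights d π) (ℤₚ.+-identityʳ c)
heights-descend (suc m) c π = trans (cong (λ d → heights d (replicate m E ++ π)) eq) (heights-descend m c π)
  where
  eq : ℤ.pred (c ℤ.+ + suc m) ≡ c ℤ.+ + m
  eq = trans (ℤₚ.+-comm -[1+ 0 ] (c ℤ.+ + suc m)) (ℤₚ.+-assoc c (+ suc m) -[1+ 0 ])

countN-descend : ∀ m π → countN (replicate m E ++ π) ≡ countN π
countN-descend zero    π = refl
countN-descend (suc m) π = countN-descend m π

countE-descend : ∀ m π → countE (replicate m E ++ π) ≡ m ℕ.+ countE π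
countE-descend zero    π = refl
countE-descend (suc m) π = cong suc (countE-descend m π)

path : ∀ {c x} s → Good ((c , x) ∷ s) → ∃ λ π →
  heights c π ≡ map proj₁ s × countN π ≡ length s × c ℤ.+ + countN π ≡ + countE π
-- The final run of E's leads from the last level back to height 0; nonnegativity of that level
-- makes this possible.
path []            (_ , +≤+ {n = m} z≤n) = replicate m E ++ [] ,
    heights-descend m (+ 0) []
  , countN-descend m []
  , trans (cong (λ v → + m ℤ.+ + v) (countN-descend m [])) (cong +_ (sym (countE-descend m [])))
-- Here m = c + 1 - d: so many E's lead to height d - 1, from which one N reaches d.
path {c} ((d , y) ∷ s) ((r , _) ∷ l , p) with path s (l , p) | descend r
... | π , h , cn , f | m , e = replicate m E ++ N ∷ π ,
    trans (cong (λ v → heights v (replicate m E ++ N ∷ π)) c≡)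
      (trans (heights-descend m (ℤ.pred d) (N ∷ π)) (cong₂ _∷_ (ℤₚ.suc-pred d) (trans (cong (λ v → heights v π) (ℤₚ.suc-pred d)) h)))
  , trans (countN-descend m (N ∷ π)) (cong suc cn)
  , (begin
      c ℤ.+ + countN (replicate m E ++ N ∷ π) ≡⟨ cong (λ v → c ℤ.+ + v) (countN-descend m (N ∷ π)) ⟩
      c ℤ.+ + suc (countN π)                  ≡⟨ ℤₚ.+-assoc c (+ 1) (+ countN π) ⟨
      (c ℤ.+ + 1) ℤ.+ + countN π              ≡⟨ cong (ℤ._+ + countN π) (trans (ℤₚ.+-comm c (+ 1)) (trans e (ℤₚ.+-comm d (+ m)))) ⟩
      (+ m ℤ.+ d) ℤ.+ + countN π              ≡⟨ ℤₚ.+-assoc (+ m) d (+ countN π) ⟩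
      + m ℤ.+ (d ℤ.+ + countN π)              ≡⟨ cong (λ v → + m ℤ.+ v) f ⟩
      + (m ℕ.+ countE π)                      ≡⟨ cong +_ (countE-descend m (N ∷ π)) ⟨
      + countE (replicate m E ++ N ∷ π)       ∎)
  where
  open ≡-Reasoning
  c≡ : c ≡ ℤ.pred d ℤ.+ + m
  c≡ = trans (sym (ℤₚ.pred-suc c)) (trans (cong ℤ.pred e) (sym (ℤₚ.pred-+ d (+ m))))

-- ζ and the reading word as breadth-first codes

level : ℕ → List Item → List ℤ
level zero    A = zeros A
level (suc i) A = level i (lower A)

layer : ℕ → List Item → List Letter
layer zero    A = base A
layer (suc j) A = layer j (lower A)

level-[] : ∀ i → level i [] ≡ []
level-[] zero    = refl
level-[] (suc i) = level-[] i

layer-[] : ∀ j → layer j [] ≡ []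
layer-[] zero    = refl
layer-[] (suc j) = layer-[] j

level-∷ : ∀ i k x A → level i ((k , x) ∷ A) ≡ (if k ℕ.≡ᵇ i then x ∷ [] else []) ++ level i A
level-∷ zero    zero    x A = refl
level-∷ zero    (suc k) x A = refl
level-∷ (suc i) zero    x A = refl
level-∷ (suc i) (suc k) x A = level-∷ i k x (lower A)

layer-∷ : ∀ j k x A → layer j ((k , x) ∷ A) ≡
  (if k ℕ.≡ᵇ j then (N , x) ∷ [] else (if k ℕ.≡ᵇ suc j then (E , x) ∷ [] else [])) ++ layer j A
layer-∷ zero    zero          x A = refl
layer-∷ zero    (suc zero)    x A = refl
layer-∷ zero    (suc (suc k)) x A = refl
layer-∷ (suc j) zero          x A = refl
layer-∷ (suc j) (suc k)       x A = layer-∷ j k x (lower A)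

-- All filters in use send a single entry to a list of length at most one, hence to a palindrome.
reverse-hom : ∀ {X Y : Set} (h : List X → List Y) → h [] ≡ [] → (∀ xs ys → h (xs ++ ys) ≡ h xs ++ h ys) →
  (∀ x → reverse (h (x ∷ [])) ≡ h (x ∷ [])) → ∀ xs → h (reverse xs) ≡ reverse (h xs)
reverse-hom h h[] h++ h₁ []       = trans h[] (cong reverse (sym h[]))
reverse-hom h h[] h++ h₁ (x ∷ xs) = begin
  h (reverse (x ∷ xs))                 ≡⟨ cong h (unfold-reverse x xs) ⟩
  h (reverse xs ++ x ∷ [])             ≡⟨ h++ (reverse xs) (x ∷ []) ⟩
  h (reverse xs) ++ h (x ∷ [])         ≡⟨ cong₂ _++_ (reverse-hom h h[] h++ h₁ xs) (sym (h₁ x)) ⟩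
  reverse (h xs) ++ reverse (h (x ∷ [])) ≡⟨ reverse-++ (h (x ∷ [])) (h xs) ⟨
  reverse (h (x ∷ []) ++ h xs)         ≡⟨ cong reverse (h++ (x ∷ []) xs) ⟨
  reverse (h (x ∷ xs))                 ∎
  where open ≡-Reasoning

zeros-++ : ∀ A B → zeros (A ++ B) ≡ zeros A ++ zeros B
zeros-++ []                B = refl
zeros-++ ((zero  , x) ∷ A) B = cong (x ∷_) (zeros-++ A B)
zeros-++ ((suc _ , _) ∷ A) B = zeros-++ A B

lower-++ : ∀ A B → lower (A ++ B) ≡ lower A ++ lower B
lower-++ []                B = refl
lower-++ ((zero  , _) ∷ A) B = lower-++ A B
lower-++ ((suc k , x) ∷ A) B = cong ((k , x) ∷_) (lower-++ A B)

base-++ : ∀ A B → base (A ++ B) ≡ base A ++ base B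
base-++ []                      B = refl
base-++ ((zero        , x) ∷ A) B = cong ((N , x) ∷_) (base-++ A B)
base-++ ((suc zero    , x) ∷ A) B = cong ((E , x) ∷_) (base-++ A B)
base-++ ((suc (suc _) , _) ∷ A) B = base-++ A B

zeros-reverse : ∀ A → zeros (reverse A) ≡ reverse (zeros A)
zeros-reverse = reverse-hom zeros refl zeros-++ λ { (zero , _) → refl ; (suc _ , _) → refl }

lower-reverse : ∀ A → lower (reverse A) ≡ reverse (lower A)
lower-reverse = reverse-hom lower refl lower-++ λ { (zero , _) → refl ; (suc _ , _) → refl }

base-reverse : ∀ A → base (reverse A) ≡ reverse (base A)
base-reverse = reverse-hom base refl base-++
  λ { (zero , _) → refl ; (suc zero , _) → refl ; (suc (suc _) , _) → refl }

level-reverse : ∀ i A → level i (reverse A) ≡ reverse (level i A)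
level-reverse zero    A = zeros-reverse A
level-reverse (suc i) A = trans (cong (level i) (lower-reverse A)) (level-reverse i (lower A))

layer-reverse : ∀ j A → layer j (reverse A) ≡ reverse (layer j A)
layer-reverse zero    A = base-reverse A
layer-reverse (suc j) A = trans (cong (layer j) (lower-reverse A)) (layer-reverse j (lower A))

reverse-concatMap : ∀ {X Y : Set} (f : X → List Y) xs →
  reverse (concatMap f (reverse xs)) ≡ concatMap (reverse ∘ f) xs
reverse-concatMap f []       = refl
reverse-concatMap f (x ∷ xs) = begin
  reverse (concatMap f (reverse (x ∷ xs)))            ≡⟨ cong (reverse ∘ concatMap f) (unfold-reverse x xs) ⟩
  reverse (concatMap f (reverse xs ++ x ∷ []))        ≡⟨ cong reverse (concatMap-++ f (reverse xs) (x ∷ [])) ⟩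
  reverse (concatMap f (reverse xs) ++ (f x ++ []))   ≡⟨ reverse-++ (concatMap f (reverse xs)) _ ⟩
  reverse (f x ++ []) ++ reverse (concatMap f (reverse xs)) ≡⟨ cong₂ _++_ (cong reverse (++-identityʳ (f x))) (reverse-concatMap f xs) ⟩
  reverse (f x) ++ concatMap (reverse ∘ f) xs         ∎
  where open ≡-Reasoning

Splus-layer : ∀ j s → Splus→ j (map proj₁ s) ≡ map proj₁ (layer j (pos s))
Splus-layer j []                   = sym (cong (map proj₁) (layer-[] j))
Splus-layer j ((-[1+ _ ] , _) ∷ s) = Splus-layer j s
Splus-layer j ((+ k , x) ∷ s) rewrite layer-∷ j k x (pos s) with k ℕ.≡ᵇ j | k ℕ.≡ᵇ suc j
... | true  | _     = cong (N ∷_) (Splus-layer j s)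
... | false | true  = cong (E ∷_) (Splus-layer j s)
... | false | false = Splus-layer j s

Sminus-layer : ∀ j s → Sminus→ j (map proj₁ s) ≡ map proj₁ (layer j (neg s))
Sminus-layer j []                   = sym (cong (map proj₁) (layer-[] j))
Sminus-layer zero    ((+ zero , _) ∷ s)         = cong (N ∷_) (Sminus-layer zero s)
Sminus-layer (suc j) ((+ zero , _) ∷ s)         = Sminus-layer (suc j) s
Sminus-layer zero    ((+ suc _ , _) ∷ s)        = Sminus-layer zero s
Sminus-layer (suc j) ((+ suc _ , _) ∷ s)        = Sminus-layer (suc j) s
Sminus-layer zero    ((-[1+ zero ] , _) ∷ s)    = cong (E ∷_) (Sminus-layer zero s)
Sminus-layer zero    ((-[1+ suc _ ] , _) ∷ s)   = Sminus-layer zero s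
Sminus-layer (suc j) ((-[1+ k ] , x) ∷ s) rewrite layer-∷ (suc j) (suc k) (- x) (neg s) with k ℕ.≡ᵇ j | k ℕ.≡ᵇ suc j
... | true  | _     = cong (N ∷_) (Sminus-layer (suc j) s)
... | false | true  = cong (E ∷_) (Sminus-layer (suc j) s)
... | false | false = Sminus-layer (suc j) s

concat-layers : ∀ k A B → concat (applyUpTo (λ j → map proj₁ (layer j A ++ layer j B)) k) ≡ map proj₁ (bfs k A B)
concat-layers zero    A B = refl
concat-layers (suc k) A B = begin
  map proj₁ (base A ++ base B) ++ _                             ≡⟨ cong (map proj₁ (base A ++ base B) ++_) (concat-layers k (lower A) (lower B)) ⟩
  map proj₁ (base A ++ base B) ++ map proj₁ (bfs k (lower A) (lower B)) ≡⟨ map-++ proj₁ (base A ++ base B) _ ⟨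
  map proj₁ ((base A ++ base B) ++ bfs k (lower A) (lower B))   ≡⟨ cong (map proj₁) (++-assoc (base A) _ _) ⟩
  map proj₁ (bfs (suc k) A B)                                   ∎
  where open ≡-Reasoning

concat-levels : ∀ k A B → concat (applyUpTo (λ i → level i B ++ level (suc i) A) k) ≡ order k A B
concat-levels zero    A B = refl
concat-levels (suc k) A B = cong ((zeros B ++ zeros (lower A)) ++_) (concat-levels k (lower A) (lower B))

-- Reversal puts block 0 first and the S⁺ word in front of the S⁻ word. As `reverse μ` is the list
-- of heights, the S⁺ word now runs along the path and the S⁻ word against it, which is why the
-- nonpositive half enters reversed.
zeta-bfs : ∀ n π u → countN π ≡ n → let s = points (at u) (+ 0) 0 π in
  reverse (zetaC n π) ≡ map proj₁ (bfs (suc n) (pos s) (reverse (neg s)))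
zeta-bfs n π u e = begin
  reverse (zetaC n π)
    ≡⟨ reverse-concatMap (λ j → Sminus← j μ ++ Splus→ j μ) (upTo (suc n)) ⟩
  concatMap (λ j → reverse (Sminus← j μ ++ Splus→ j μ)) (upTo (suc n))
    ≡⟨ concatMap-cong block (upTo (suc n)) ⟩
  concatMap (λ j → map proj₁ (layer j (pos s) ++ layer j (reverse (neg s)))) (upTo (suc n))
    ≡⟨ cong concat (map-upTo _ (suc n)) ⟩
  concat (applyUpTo (λ j → map proj₁ (layer j (pos s) ++ layer j (reverse (neg s)))) (suc n))
    ≡⟨ concat-layers (suc n) (pos s) (reverse (neg s)) ⟩
  map proj₁ (bfs (suc n) (pos s) (reverse (neg s))) ∎
  where
  open ≡-Reasoning
  μ = muList n π
  s = points (at u) (+ 0) 0 π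
  rμ : reverse μ ≡ map proj₁ s
  rμ = trans (reverse-muList n π e) (sym (levels-points (at u) (+ 0) 0 π))
  Splus-reverse : ∀ j a → Splus→ j (reverse a) ≡ reverse (Splus→ j a)
  Splus-reverse j = reverse-hom (Splus→ j) refl (concatMap-++ _) single
    where
    single : ∀ x → reverse (Splus→ j (x ∷ [])) ≡ Splus→ j (x ∷ [])
    single x with eqℤ x (+ j) | eqℤ x (+ suc j)
    ... | true  | _     = refl
    ... | false | true  = refl
    ... | false | false = refl
  block : ∀ j → reverse (Sminus← j μ ++ Splus→ j μ) ≡ map proj₁ (layer j (pos s) ++ layer j (reverse (neg s)))
  block j = begin
    reverse (Sminus→ j (reverse μ) ++ Splus→ j μ)
      ≡⟨ reverse-++ (Sminus→ j (reverse μ)) (Splus→ j μ) ⟩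
    reverse (Splus→ j μ) ++ reverse (Sminus→ j (reverse μ))
      ≡⟨ cong₂ _++_ (sym (Splus-reverse j μ)) refl ⟩
    Splus→ j (reverse μ) ++ reverse (Sminus→ j (reverse μ))
      ≡⟨ cong₂ _++_ (cong (Splus→ j) rμ) (cong (reverse ∘ Sminus→ j) rμ) ⟩
    Splus→ j (map proj₁ s) ++ reverse (Sminus→ j (map proj₁ s))
      ≡⟨ cong₂ _++_ (Splus-layer j s) (cong reverse (Sminus-layer j s)) ⟩
    map proj₁ (layer j (pos s)) ++ reverse (map proj₁ (layer j (neg s)))
      ≡⟨ cong (map proj₁ (layer j (pos s)) ++_) (trans (sym (reverse-map proj₁ (layer j (neg s)))) (cong (map proj₁) (sym (layer-reverse j (neg s))))) ⟩
    map proj₁ (layer j (pos s)) ++ map proj₁ (layer j (reverse (neg s)))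
      ≡⟨ map-++ proj₁ (layer j (pos s)) _ ⟨
    map proj₁ (layer j (pos s) ++ layer j (reverse (neg s))) ∎

map-filterᵇ : ∀ {X : Set} (F : X → Point) (q : ℤ → Bool) (h : ℤ → ℤ) xs →
  map (λ x → h (proj₂ (F x))) (filterᵇ (λ x → q (proj₁ (F x))) xs) ≡ map (h ∘ proj₂) (filterᵇ (q ∘ proj₁) (map F xs))
map-filterᵇ F q h []       = refl
map-filterᵇ F q h (x ∷ xs) with q (proj₁ (F x))
... | true  = cong (h (proj₂ (F x)) ∷_) (map-filterᵇ F q h xs)
... | false = map-filterᵇ F q h xs

level-pos : ∀ i s → map proj₂ (filterᵇ (λ p → eqℤ (proj₁ p) (+ i)) s) ≡ level i (pos s)
level-pos i []                   = sym (level-[] i)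
level-pos i ((-[1+ _ ] , _) ∷ s) = level-pos i s
level-pos i ((+ k , x) ∷ s) rewrite level-∷ i k x (pos s) with k ℕ.≡ᵇ i
... | true  = cong (x ∷_) (level-pos i s)
... | false = level-pos i s

level-neg : ∀ i s → map (-_ ∘ proj₂) (filterᵇ (λ p → eqℤ (proj₁ p) (- + i)) s) ≡ level i (neg s)
level-neg i       []                   = sym (level-[] i)
level-neg zero    ((+ zero , x) ∷ s)   = cong (- x ∷_) (level-neg zero s)
level-neg (suc i) ((+ zero , _) ∷ s)   = level-neg (suc i) s
level-neg zero    ((+ suc _ , _) ∷ s)  = level-neg zero s
level-neg (suc i) ((+ suc _ , _) ∷ s)  = level-neg (suc i) s
level-neg zero    ((-[1+ _ ] , _) ∷ s) = level-neg zero s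
level-neg (suc i) ((-[1+ k ] , x) ∷ s) rewrite level-∷ (suc i) (suc k) (- x) (neg s) with k ℕ.≡ᵇ i
... | true  = cong (- x ∷_) (level-neg (suc i) s)
... | false = level-neg (suc i) s

-- Decreasing j runs through the nonpositive half against the path, increasing j through the other
-- half along it: the same directions as in the code.
dC-order : ∀ n π u → countN π ≡ n → let s = points (at u) (+ 0) 0 π in
  dC n π u ≡ order (suc n) (pos s) (reverse (neg s))
dC-order n π u e = begin
  dC n π u
    ≡⟨ concatMap-cong block (upTo (suc n)) ⟩
  concatMap (λ i → level i (reverse (neg s)) ++ level (suc i) (pos s)) (upTo (suc n))
    ≡⟨ cong concat (map-upTo _ (suc n)) ⟩
  concat (applyUpTo (λ i → level i (reverse (neg s)) ++ level (suc i) (pos s)) (suc n))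
    ≡⟨ concat-levels (suc n) (pos s) (reverse (neg s)) ⟩
  order (suc n) (pos s) (reverse (neg s)) ∎
  where
  open ≡-Reasoning
  s = points (at u) (+ 0) 0 π
  F : ℕ → Point
  F j = mu n π (suc n ∸ j) , at u j
  block : ∀ i →
    map (λ j → - at u j) (reverse (filterᵇ (λ j → eqℤ (mu n π (suc n ∸ j)) (- + i)) (oneTo n)))
      ++ map (λ j → at u j) (filterᵇ (λ j → eqℤ (mu n π (suc n ∸ j)) (+ suc i)) (oneTo n))
    ≡ level i (reverse (neg s)) ++ level (suc i) (pos s)
  block i = cong₂ _++_
    (begin
      map (λ j → - at u j) (reverse (filterᵇ (λ j → eqℤ (mu n π (suc n ∸ j)) (- + i)) (oneTo n)))
        ≡⟨ reverse-map _ (filterᵇ _ (oneTo n)) ⟩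
      reverse (map (λ j → - at u j) (filterᵇ (λ j → eqℤ (mu n π (suc n ∸ j)) (- + i)) (oneTo n)))
        ≡⟨ cong reverse (map-filterᵇ F (λ d → eqℤ d (- + i)) -_ (oneTo n)) ⟩
      reverse (map (-_ ∘ proj₂) (filterᵇ (λ p → eqℤ (proj₁ p) (- + i)) (map F (oneTo n))))
        ≡⟨ cong (λ v → reverse (map (-_ ∘ proj₂) (filterᵇ (λ p → eqℤ (proj₁ p) (- + i)) v))) (points-mu n π u e) ⟩
      reverse (map (-_ ∘ proj₂) (filterᵇ (λ p → eqℤ (proj₁ p) (- + i)) s))
        ≡⟨ cong reverse (level-neg i s) ⟩
      reverse (level i (neg s))
        ≡⟨ level-reverse i (neg s) ⟨
      level i (reverse (neg s)) ∎)
    (trans (map-filterᵇ F (λ d → eqℤ d (+ suc i)) id (oneTo n))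
      (trans (cong (λ v → map proj₂ (filterᵇ (λ p → eqℤ (proj₁ p) (+ suc i)) v)) (points-mu n π u e)) (level-pos (suc i) s)))

-- The reading word is a signed permutation

labels : List Item → List ℤ
labels = map proj₂

zeros-lower-↭ : ∀ A → zeros A ++ labels (lower A) ↭ labels A
zeros-lower-↭ []                = ↭-refl
zeros-lower-↭ ((zero  , x) ∷ A) = ↭-prep x (zeros-lower-↭ A)
zeros-lower-↭ ((suc _ , x) ∷ A) = ↭-trans (shift x (zeros A) (labels (lower A))) (↭-prep x (zeros-lower-↭ A))

-- Omitting the zeros of `A` is what makes the listing one-to-one on the points, since each zero of
-- the path also lies in `B`.
order-↭ : ∀ k A B → Below k A → Below k B → order k A B ↭ labels (lower A) ++ labels B
order-↭ zero    A B a b rewrite below-zero a | below-zero b = ↭-refl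
order-↭ (suc k) A B a b = begin
  (zB ++ zA) ++ order k (lower A) (lower B) ↭⟨ ++⁺ˡ (zB ++ zA) (order-↭ k _ _ (below-lower a) (below-lower b)) ⟩
  (zB ++ zA) ++ X ++ Y     ≡⟨ ++-assoc zB zA (X ++ Y) ⟩
  zB ++ zA ++ X ++ Y       ≡⟨ cong (zB ++_) (++-assoc zA X Y) ⟨
  zB ++ (zA ++ X) ++ Y     ↭⟨ shifts zB (zA ++ X) ⟩
  (zA ++ X) ++ zB ++ Y     ↭⟨ ++⁺ (zeros-lower-↭ (lower A)) (zeros-lower-↭ B) ⟩
  labels (lower A) ++ labels B ∎
  where
  open PermutationReasoning
  zA = zeros (lower A)
  zB = zeros B
  X  = labels (lower (lower A))
  Y  = labels (lower B)

abs-↭ : ∀ s → map ∣_∣ (labels (lower (pos s))) ++ map ∣_∣ (labels (neg s)) ↭ map ∣_∣ (map proj₂ s)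
abs-↭ []                   = ↭-refl
abs-↭ ((+ suc _  , x) ∷ s) = ↭-prep ∣ x ∣ (abs-↭ s)
abs-↭ ((+ zero   , x) ∷ s) rewrite ℤₚ.∣-i∣≡∣i∣ x =
  ↭-trans (shift ∣ x ∣ (map ∣_∣ (labels (lower (pos s)))) _) (↭-prep ∣ x ∣ (abs-↭ s))
abs-↭ ((-[1+ _ ] , x) ∷ s) rewrite ℤₚ.∣-i∣≡∣i∣ x =
  ↭-trans (shift ∣ x ∣ (map ∣_∣ (labels (lower (pos s)))) _) (↭-prep ∣ x ∣ (abs-↭ s))

abs-order-↭ : ∀ k s → Below k (pos s) → Below k (reverse (neg s)) →
  map ∣_∣ (order k (pos s) (reverse (neg s))) ↭ map ∣_∣ (map proj₂ s)
abs-order-↭ k s a b = begin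
  map ∣_∣ (order k (pos s) (reverse (neg s)))
    ↭⟨ map⁺ ∣_∣ (order-↭ k (pos s) (reverse (neg s)) a b) ⟩
  map ∣_∣ (labels (lower (pos s)) ++ labels (reverse (neg s)))
    ≡⟨ map-++ ∣_∣ (labels (lower (pos s))) _ ⟩
  map ∣_∣ (labels (lower (pos s))) ++ map ∣_∣ (labels (reverse (neg s)))
    ↭⟨ ++⁺ˡ _ (map⁺ ∣_∣ (map⁺ proj₂ (↭-reverse (neg s)))) ⟩
  map ∣_∣ (labels (lower (pos s))) ++ map ∣_∣ (labels (neg s))
    ↭⟨ abs-↭ s ⟩
  map ∣_∣ (map proj₂ s) ∎
  where open PermutationReasoning

-- Valleys and the ballot condition

-- The convention for a final E just adds the ordinary valley produced by an appended N; for e = k =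
-- 0 the right-hand side is `valleys β`.
valleys-∷ʳ : ∀ e k β → valleysFrom e k (β ++ N ∷ []) ≡
  valleysFrom e k β ++ (if endsWithE β then (e ℕ.+ countE β , suc (k ℕ.+ countN β)) ∷ [] else [])
valleys-∷ʳ e k []           = refl
valleys-∷ʳ e k (N ∷ [])     = refl
valleys-∷ʳ e k (E ∷ [])     =
  cong (_∷ []) (cong₂ _,_ (sym (ℕₚ.+-comm e 1)) (cong suc (sym (ℕₚ.+-identityʳ k))))
valleys-∷ʳ e k (N ∷ x ∷ β)  = trans (valleys-∷ʳ e (suc k) (x ∷ β))
  (cong (λ v → valleysFrom e (suc k) (x ∷ β) ++ (if endsWithE (x ∷ β) then (e ℕ.+ countE (x ∷ β) , suc v) ∷ [] else []))
    (sym (ℕₚ.+-suc k (countN (x ∷ β)))))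
valleys-∷ʳ e k (E ∷ N ∷ β)  = cong (_ ∷_) (trans (valleys-∷ʳ (suc e) k (N ∷ β))
  (cong (λ v → valleysFrom (suc e) k (N ∷ β) ++ (if endsWithE (N ∷ β) then (v , suc (k ℕ.+ countN (N ∷ β))) ∷ [] else []))
    (sym (ℕₚ.+-suc e (countE (N ∷ β))))))
valleys-∷ʳ e k (E ∷ E ∷ β)  = trans (valleys-∷ʳ (suc e) k (E ∷ β))
  (cong (λ v → valleysFrom (suc e) k (E ∷ β) ++ (if endsWithE (E ∷ β) then (v , suc (k ℕ.+ countN (E ∷ β))) ∷ [] else []))
    (sym (ℕₚ.+-suc e (countE (E ∷ β)))))

tag : (f g : ℕ → ℤ) → ℕ → ℕ → List Step → List Letter
tag f g e k []      = []
tag f g e k (E ∷ β) = (E , f (suc e)) ∷ tag f g (suc e) k β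
tag f g e k (N ∷ β) = (N , g (suc k)) ∷ tag f g e (suc k) β

steps-tag : ∀ f g e k β → map proj₁ (tag f g e k β) ≡ β
steps-tag f g e k []      = refl
steps-tag f g e k (E ∷ β) = cong (E ∷_) (steps-tag f g (suc e) k β)
steps-tag f g e k (N ∷ β) = cong (N ∷_) (steps-tag f g e (suc k) β)

labelsE-tag : ∀ f g e k β → labelsE (tag f g e k β) ≡ applyUpTo (λ t → f (suc (e ℕ.+ t))) (countE β)
labelsE-tag f g e k []      = refl
labelsE-tag f g e k (N ∷ β) = labelsE-tag f g e (suc k) β
labelsE-tag f g e k (E ∷ β) =
  trans (cong (f (suc e) ∷_) (labelsE-tag f g (suc e) k β)) (sym (applyUpTo-shift (f ∘ suc) e (countE β)))

labelsN-tag : ∀ f g e k β → labelsN (tag f g e k β) ≡ applyUpTo (λ t → g (suc (k ℕ.+ t))) (countN β)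
labelsN-tag f g e k []      = refl
labelsN-tag f g e k (E ∷ β) = labelsN-tag f g (suc e) k β
labelsN-tag f g e k (N ∷ β) =
  trans (cong (g (suc k) ∷_) (labelsN-tag f g e (suc k) β)) (sym (applyUpTo-shift (g ∘ suc) k (countN β)))

linked⇒valleys : ∀ f g e k β → Linked (flip Rise) (tag f g e k β) →
  ∀ i j → (i , j) ∈ valleysFrom e k β → g j ℤ.< f i
linked⇒valleys f g e k (E ∷ N ∷ β) (s ∷ _) i j (here refl) = s
linked⇒valleys f g e k (E ∷ N ∷ β) (_ ∷ l) i j (there m)   = linked⇒valleys f g (suc e) k (N ∷ β) l i j m
linked⇒valleys f g e k (E ∷ E ∷ β) (_ ∷ l) i j m           = linked⇒valleys f g (suc e) k (E ∷ β) l i j m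
linked⇒valleys f g e k (N ∷ β)     l       i j m           = linked⇒valleys f g e (suc k) β (Linked.tail l) i j m

valleys⇒linked : ∀ f g e k β → (∀ i j → (i , j) ∈ valleysFrom e k β → g j ℤ.< f i) →
  Linked (flip Rise) (tag f g e k β)
valleys⇒linked f g e k []          _ = []
valleys⇒linked f g e k (E ∷ [])    _ = [-]
valleys⇒linked f g e k (N ∷ [])    _ = [-]
valleys⇒linked f g e k (E ∷ N ∷ β) v = v _ _ (here refl) ∷ valleys⇒linked f g (suc e) k (N ∷ β) (λ i j → v i j ∘ there)
valleys⇒linked f g e k (E ∷ E ∷ β) v = tt ∷ valleys⇒linked f g (suc e) k (E ∷ β) v
valleys⇒linked f g e k (N ∷ N ∷ β) v = tt ∷ valleys⇒linked f g e (suc k) (N ∷ β) v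
valleys⇒linked f g e k (N ∷ E ∷ β) v = tt ∷ valleys⇒linked f g e (suc k) (E ∷ β) v

word-ext : ∀ R R′ → map proj₁ R ≡ map proj₁ R′ → labelsN R ≡ labelsN R′ → labelsE R ≡ labelsE R′ → R ≡ R′
word-ext []            []            _ _ _ = refl
word-ext ((N , x) ∷ R) ((N , y) ∷ R′) p q r =
  cong₂ (λ v → (N , v) ∷_) (∷-injectiveˡ q) (word-ext R R′ (∷-injectiveʳ p) (∷-injectiveʳ q) r)
word-ext ((E , x) ∷ R) ((E , y) ∷ R′) p q r =
  cong₂ (λ v → (E , v) ∷_) (∷-injectiveˡ r) (word-ext R R′ (∷-injectiveʳ p) q (∷-injectiveʳ r))

spell : List Step → List ℤ → List ℤ → List Letter
spell (N ∷ β) (x ∷ xs) ys       = (N , x) ∷ spell β xs ys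
spell (E ∷ β) xs       (y ∷ ys) = (E , y) ∷ spell β xs ys
spell _       _        _        = []

spell-correct : ∀ β xs ys → countN β ≡ length xs → countE β ≡ length ys →
  let R = spell β xs ys in map proj₁ R ≡ β × labelsN R ≡ xs × labelsE R ≡ ys
spell-correct []      []       []       _ _ = refl , refl , refl
spell-correct (N ∷ β) (x ∷ xs) ys       p q with spell-correct β xs ys (ℕₚ.suc-injective p) q
... | a , b , c = cong (N ∷_) a , cong (x ∷_) b , c
spell-correct (E ∷ β) xs       (y ∷ ys) p q with spell-correct β xs ys p (ℕₚ.suc-injective q)
... | a , b , c = cong (E ∷_) a , b , cong (y ∷_) c

countN-steps : ∀ R → countN (map proj₁ R) ≡ length (labelsN R)
countN-steps []            = refl
countN-steps ((N , _) ∷ R) = cong suc (countN-steps R)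
countN-steps ((E , _) ∷ R) = countN-steps R

countE-steps : ∀ R → countE (map proj₁ R) ≡ length (labelsE R)
countE-steps []            = refl
countE-steps ((E , _) ∷ R) = cong suc (countE-steps R)
countE-steps ((N , _) ∷ R) = countE-steps R

countN-↭ : ∀ {α β} → α ↭ β → countN α ≡ countN β
countN-↭ _↭_.refl                 = refl
countN-↭ (_↭_.prep N p)           = cong suc (countN-↭ p)
countN-↭ (_↭_.prep E p)           = countN-↭ p
countN-↭ (_↭_.swap N N p)         = cong (suc ∘ suc) (countN-↭ p)
countN-↭ (_↭_.swap N E p)         = cong suc (countN-↭ p)
countN-↭ (_↭_.swap E N p)         = cong suc (countN-↭ p)
countN-↭ (_↭_.swap E E p)         = countN-↭ p
countN-↭ (_↭_.trans p q)          = trans (countN-↭ p) (countN-↭ q)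

length-count : ∀ β → countE β ℕ.+ countN β ≡ length β
length-count []      = refl
length-count (E ∷ β) = cong suc (length-count β)
length-count (N ∷ β) = trans (ℕₚ.+-suc (countE β) (countN β)) (cong suc (length-count β))

countN-reverse : ∀ β → countN (reverse β) ≡ countN β
countN-reverse β = countN-↭ (↭-reverse β)

countE-reverse : ∀ β → countE (reverse β) ≡ countE β
countE-reverse β = ℕₚ.+-cancelʳ-≡ (countN β) _ _ (begin
  countE (reverse β) ℕ.+ countN β           ≡⟨ cong (countE (reverse β) ℕ.+_) (countN-reverse β) ⟨
  countE (reverse β) ℕ.+ countN (reverse β) ≡⟨ length-count (reverse β) ⟩
  length (reverse β)                        ≡⟨ length-reverse β ⟩
  length β                                  ≡⟨ length-count β ⟨
  countE β ℕ.+ countN β                     ∎)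
  where open ≡-Reasoning

suffixes⇒ballot : ∀ R → (∀ xs ys → map proj₁ R ≡ xs ++ ys → countE ys ≤ countN ys) → Ballot R
suffixes⇒ballot []      _ = tt
suffixes⇒ballot (l ∷ R) h =
    subst₂ _≤_ (countE-steps (l ∷ R)) (countN-steps (l ∷ R)) (h [] _ refl)
  , suffixes⇒ballot R (λ xs ys e → h (proj₁ l ∷ xs) ys (cong (proj₁ l ∷_) e))

ballot⇒suffixes : ∀ R → Ballot R → ∀ xs ys → map proj₁ R ≡ xs ++ ys → countE ys ≤ countN ys
ballot⇒suffixes []      _       []       ys refl = z≤n
ballot⇒suffixes (l ∷ R) (b , _) []       ys refl = subst₂ _≤_ (sym (countE-steps (l ∷ R))) (sym (countN-steps (l ∷ R))) b
ballot⇒suffixes (l ∷ R) (_ , b) (x ∷ xs) ys e    = ballot⇒suffixes R b xs ys (∷-injectiveʳ e)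

take-length-++ : ∀ {X : Set} (xs ys : List X) → take (length xs) (xs ++ ys) ≡ xs
take-length-++ []       ys = refl
take-length-++ (x ∷ xs) ys = cong (x ∷_) (take-length-++ xs ys)

prefixes⇒ballot : ∀ β R → map proj₁ R ≡ reverse β → (∀ k → countE (take k β) ≤ countN (take k β)) → Ballot R
prefixes⇒ballot β R e h = suffixes⇒ballot R λ xs ys p →
  subst₂ _≤_ (countE-reverse ys) (countN-reverse ys)
    (subst (λ v → countE v ≤ countN v) (prefix xs ys p) (h (length (reverse ys))))
  where
  prefix : ∀ xs ys → map proj₁ R ≡ xs ++ ys → take (length (reverse ys)) β ≡ reverse ys
  prefix xs ys p = trans (cong (take (length (reverse ys)))
    (trans (sym (reverse-involutive β)) (trans (cong reverse (trans (sym e) p)) (reverse-++ xs ys))))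
    (take-length-++ (reverse ys) (reverse xs))

ballot⇒prefixes : ∀ β R → map proj₁ R ≡ reverse β → Ballot R → ∀ k → countE (take k β) ≤ countN (take k β)
ballot⇒prefixes β R e b k = subst₂ _≤_ (countE-reverse (take k β)) (countN-reverse (take k β))
  (ballot⇒suffixes R b (reverse (drop k β)) (reverse (take k β))
    (trans e (trans (cong reverse (sym (take++drop≡id k β))) (reverse-++ (take k β) (drop k β)))))

-- The valley condition as a rise condition on the labelled code

labelsN-reverse : ∀ R → labelsN (reverse R) ≡ reverse (labelsN R)
labelsN-reverse = reverse-hom labelsN refl labelsN-++ λ { (N , _) → refl ; (E , _) → refl }

labelsE-reverse : ∀ R → labelsE (reverse R) ≡ reverse (labelsE R)
labelsE-reverse = reverse-hom labelsE refl labelsE-++ λ { (N , _) → refl ; (E , _) → refl }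

reverse-at : ∀ w → reverse w ≡ applyUpTo (λ t → at w (length w ∸ t)) (length w)
reverse-at w = begin
  reverse w                                      ≡⟨ cong reverse (at-applyUpTo w) ⟨
  reverse (applyUpTo (at w ∘ suc) (length w))    ≡⟨ reverse-applyUpTo _ (length w) ⟩
  applyDownFrom (at w ∘ suc) (length w)          ≡⟨ applyDownFrom-∸ _ (length w) ⟩
  applyUpTo (λ t → at w (suc (length w ∸ suc t))) (length w)
    ≡⟨ applyUpTo-cong (length w) (λ l → cong (at w) (sym (ℕₚ.+-∸-assoc 1 l))) ⟩
  applyUpTo (λ t → at w (length w ∸ t)) (length w) ∎
  where open ≡-Reasoning

at-++ : ∀ xs ys → applyUpTo (at (xs ++ ys) ∘ suc) (length xs) ≡ xs
at-++ []       ys = refl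
at-++ (x ∷ xs) ys = cong (x ∷_) (at-++ xs ys)

at-middle : ∀ xs y ys → at (xs ++ y ∷ ys) (suc (length xs)) ≡ y
at-middle []       y ys = refl
at-middle (x ∷ xs) y ys = at-middle xs y ys

neg<self : ∀ {y} → + 0 ℤ.< y → - y ℤ.< y
neg<self p = ℤₚ.<-trans (ℤₚ.neg-mono-< p) p

neg<self⁻ : ∀ {y} → - y ℤ.< y → + 0 ℤ.< y
neg<self⁻ {+ suc _}    _ = ℤ.+<+ (s≤s z≤n)
neg<self⁻ {+ zero}     (ℤ.+<+ ())
neg<self⁻ { -[1+ _ ] } ()

-- Shared by both directions: `R` may be the code of a given pair (π, u), or be spelled out from a
-- given (β, w).
module Diagonal (Z V : List ℤ) (β : List Step) (R : List Letter)
  (steps : map proj₁ R ≡ reverse β)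
  (namesN : labelsN R ≡ reverse (map -_ Z) ++ (Z ++ V))
  (namesE : labelsE R ≡ V) where

  w : List ℤ
  w = Z ++ V

  n z : ℕ
  n = length w
  z = length Z

  -- The label that the definition gives to the virtual final N of β: it is N number n + z + 1, and
  -- w(-(z+1)) = -w(z+1). For empty `V` the index is out of range and the value 0, but then no E
  -- exists to be compared with it.
  v : ℤ
  v = - at w (suc z)

  -- The i-th E and the j-th N of β carry these labels.
  f g : ℕ → ℤ
  f i = at w (suc n ∸ i)
  g j with j ℕ.≤? n
  ... | yes _ = at w (suc n ∸ j)
  ... | no  _ = - at w (j ∸ n)

  g-≤ : ∀ {j} → j ≤ n → g j ≡ at w (suc n ∸ j)
  g-≤ {j} p with j ℕ.≤? n
  ... | yes _ = refl
  ... | no ¬p = contradiction p ¬p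

  g-> : ∀ {j} → n ℕ.< j → g j ≡ - at w (j ∸ n)
  g-> {j} p with j ℕ.≤? n
  ... | yes q = contradiction p (ℕₚ.≤⇒≯ q)
  ... | no  _ = refl

  R⁺ : List Letter
  R⁺ = reverse ((N , v) ∷ R)

  steps⁺ : map proj₁ R⁺ ≡ β ++ N ∷ []
  steps⁺ = begin
    map proj₁ (reverse ((N , v) ∷ R)) ≡⟨ reverse-map proj₁ ((N , v) ∷ R) ⟩
    reverse (N ∷ map proj₁ R)         ≡⟨ cong (λ x → reverse (N ∷ x)) steps ⟩
    reverse (N ∷ reverse β)           ≡⟨ unfold-reverse N (reverse β) ⟩
    reverse (reverse β) ++ N ∷ []     ≡⟨ cong (_++ N ∷ []) (reverse-involutive β) ⟩
    β ++ N ∷ []                       ∎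
    where open ≡-Reasoning

  countN⁺ : countN (β ++ N ∷ []) ≡ n ℕ.+ suc z
  countN⁺ = begin
    countN (β ++ N ∷ [])       ≡⟨ cong countN steps⁺ ⟨
    countN (map proj₁ R⁺)      ≡⟨ countN-steps R⁺ ⟩
    length (labelsN R⁺)        ≡⟨ cong length (labelsN-reverse ((N , v) ∷ R)) ⟩
    length (reverse (v ∷ labelsN R)) ≡⟨ length-reverse (v ∷ labelsN R) ⟩
    suc (length (labelsN R))   ≡⟨ cong (suc ∘ length) namesN ⟩
    suc (length (reverse (map -_ Z) ++ w)) ≡⟨ cong suc (length-++ (reverse (map -_ Z))) ⟩
    suc (length (reverse (map -_ Z)) ℕ.+ n) ≡⟨ cong (λ x → suc (x ℕ.+ n)) (trans (length-reverse (map -_ Z)) (length-map -_ Z)) ⟩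
    suc z ℕ.+ n                ≡⟨ ℕₚ.+-comm (suc z) n ⟩
    n ℕ.+ suc z                ∎
    where open ≡-Reasoning

  countE⁺ : countE (β ++ N ∷ []) ≡ length V
  countE⁺ = begin
    countE (β ++ N ∷ [])             ≡⟨ cong countE steps⁺ ⟨
    countE (map proj₁ R⁺)            ≡⟨ countE-steps R⁺ ⟩
    length (labelsE R⁺)              ≡⟨ cong length (labelsE-reverse ((N , v) ∷ R)) ⟩
    length (reverse (labelsE R))     ≡⟨ length-reverse (labelsE R) ⟩
    length (labelsE R)               ≡⟨ cong length namesE ⟩
    length V                         ∎
    where open ≡-Reasoning

  namesN⁺ : labelsN R⁺ ≡ applyUpTo (g ∘ suc) (countN (β ++ N ∷ []))
  namesN⁺ = begin
    labelsN R⁺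
      ≡⟨ labelsN-reverse ((N , v) ∷ R) ⟩
    reverse (v ∷ labelsN R)
      ≡⟨ unfold-reverse v (labelsN R) ⟩
    reverse (labelsN R) ++ v ∷ []
      ≡⟨ cong (λ x → reverse x ++ v ∷ []) namesN ⟩
    reverse (reverse (map -_ Z) ++ w) ++ v ∷ []
      ≡⟨ cong (_++ v ∷ []) (trans (reverse-++ (reverse (map -_ Z)) w) (cong (reverse w ++_) (reverse-involutive (map -_ Z)))) ⟩
    (reverse w ++ map -_ Z) ++ v ∷ []
      ≡⟨ ++-assoc (reverse w) (map -_ Z) (v ∷ []) ⟩
    reverse w ++ (map -_ Z ++ v ∷ [])
      ≡⟨ cong₂ _++_ (trans (reverse-at w) (applyUpTo-cong n (λ l → sym (g-≤ l)))) second ⟩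
    applyUpTo (g ∘ suc) n ++ applyUpTo (λ t → g (suc (n ℕ.+ t))) (suc z)
      ≡⟨ applyUpTo-++ (g ∘ suc) n (suc z) ⟨
    applyUpTo (g ∘ suc) (n ℕ.+ suc z)
      ≡⟨ cong (applyUpTo (g ∘ suc)) countN⁺ ⟨
    applyUpTo (g ∘ suc) (countN (β ++ N ∷ [])) ∎
    where
    open ≡-Reasoning
    second : map -_ Z ++ v ∷ [] ≡ applyUpTo (λ t → g (suc (n ℕ.+ t))) (suc z)
    second = begin
      map -_ Z ++ v ∷ []
        ≡⟨ cong (λ x → map -_ x ++ v ∷ []) (at-++ Z V) ⟨
      map -_ (applyUpTo (at w ∘ suc) z) ++ v ∷ []
        ≡⟨ cong (_++ v ∷ []) (map-applyUpTo (at w ∘ suc) -_ z) ⟩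
      applyUpTo (-_ ∘ at w ∘ suc) z ++ v ∷ []
        ≡⟨ applyUpTo-∷ʳ (-_ ∘ at w ∘ suc) z ⟩
      applyUpTo (-_ ∘ at w ∘ suc) (suc z)
        ≡⟨ applyUpTo-cong (suc z) (λ {t} _ → trans (g-> (s≤s (ℕₚ.m≤m+n n t))) (cong (λ x → - at w x)
             (trans (cong (_∸ n) (sym (ℕₚ.+-suc n t))) (ℕₚ.m+n∸m≡n n (suc t))))) ⟨
      applyUpTo (λ t → g (suc (n ℕ.+ t))) (suc z) ∎

  namesE⁺ : labelsE R⁺ ≡ applyUpTo (f ∘ suc) (countE (β ++ N ∷ []))
  namesE⁺ = begin
    labelsE R⁺                       ≡⟨ labelsE-reverse ((N , v) ∷ R) ⟩
    reverse (labelsE R)              ≡⟨ cong reverse namesE ⟩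
    reverse V                        ≡⟨ proj₁ (++-injective (reverse V) _ lengths prefix) ⟩
    applyUpTo (f ∘ suc) (length V)   ≡⟨ cong (applyUpTo (f ∘ suc)) countE⁺ ⟨
    applyUpTo (f ∘ suc) (countE (β ++ N ∷ [])) ∎
    where
    open ≡-Reasoning
    lengths : length (reverse V) ≡ length (applyUpTo (f ∘ suc) (length V))
    lengths = trans (length-reverse V) (sym (length-applyUpTo _ (length V)))
    -- `V` is the end of the window, so the E's of β, counted from the left, read w from its last
    -- entry downwards.
    prefix : reverse V ++ reverse Z ≡
      applyUpTo (f ∘ suc) (length V) ++ applyUpTo (λ t → f (suc (length V ℕ.+ t))) z
    prefix = begin
      reverse V ++ reverse Z                ≡⟨ reverse-++ Z V ⟨
      reverse w                             ≡⟨ reverse-at w ⟩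
      applyUpTo (f ∘ suc) n                 ≡⟨ cong (applyUpTo (f ∘ suc)) (trans (length-++ Z) (ℕₚ.+-comm z (length V))) ⟩
      applyUpTo (f ∘ suc) (length V ℕ.+ z)  ≡⟨ applyUpTo-++ (f ∘ suc) (length V) z ⟩
      _                                     ∎

  tagged : R⁺ ≡ tag f g 0 0 (β ++ N ∷ [])
  tagged = word-ext R⁺ _
    (trans steps⁺ (sym (steps-tag f g 0 0 (β ++ N ∷ []))))
    (trans namesN⁺ (sym (labelsN-tag f g 0 0 (β ++ N ∷ []))))
    (trans namesE⁺ (sym (labelsE-tag f g 0 0 (β ++ N ∷ []))))

  v-first : ∀ {y R′} → R ≡ (E , y) ∷ R′ → v ≡ - y
  v-first {y} {R′} e = cong -_ (trans (cong (λ x → at (Z ++ x) (suc z)) V≡) (at-middle Z y (labelsE R′)))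
    where
    V≡ : V ≡ y ∷ labelsE R′
    V≡ = trans (sym namesE) (cong labelsE e)

  -- The virtual first N is compared with w(z+1) only, so the labels 0 and -w(z+1) are interchangeable.
  relabel : Linked Rise ((N , + 0) ∷ R) → Linked Rise ((N , v) ∷ R)
  relabel = go R refl
    where
    go : ∀ S → R ≡ S → Linked Rise ((N , + 0) ∷ S) → Linked Rise ((N , v) ∷ S)
    go []            _ _       = [-]
    go ((N , _) ∷ S) _ (_ ∷ l) = tt ∷ l
    go ((E , y) ∷ S) e (p ∷ l) = subst (ℤ._< y) (sym (v-first e)) (neg<self p) ∷ l

  relabel⁻ : Linked Rise ((N , v) ∷ R) → Linked Rise ((N , + 0) ∷ R)
  relabel⁻ = go R refl
    where
    go : ∀ S → R ≡ S → Linked Rise ((N , v) ∷ S) → Linked Rise ((N , + 0) ∷ S)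
    go []            _ _       = [-]
    go ((N , _) ∷ S) _ (_ ∷ l) = tt ∷ l
    go ((E , y) ∷ S) e (p ∷ l) = neg<self⁻ (subst (ℤ._< y) (v-first e) p) ∷ l

  ValleyCondition : Set
  ValleyCondition = ∀ i j → (i , j) ∈ valleys β →
    (j ≤ n → at w (suc n ∸ j) ℤ.< at w (suc n ∸ i)) × (n ℕ.< j → - at w (j ∸ n) ℤ.< at w (suc n ∸ i))

  rise⇒valleys : Linked Rise ((N , + 0) ∷ R) → ValleyCondition
  rise⇒valleys l i j m = (λ p → subst (ℤ._< f i) (g-≤ p) v<) , (λ p → subst (ℤ._< f i) (g-> p) v<)
    where
    v< : g j ℤ.< f i
    v< = linked⇒valleys f g 0 0 (β ++ N ∷ [])
           (subst (Linked (flip Rise)) tagged (linked-reverse _ (relabel l)))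
           i j (subst ((i , j) ∈_) (sym (valleys-∷ʳ 0 0 β)) m)

  valleys⇒rise : ValleyCondition → Linked Rise ((N , + 0) ∷ R)
  valleys⇒rise c = relabel⁻ (subst (Linked Rise) (reverse-involutive ((N , v) ∷ R))
    (linked-reverse R⁺ (subst (Linked (flip Rise)) (sym tagged) (valleys⇒linked f g 0 0 (β ++ N ∷ []) below))))
    where
    below : ∀ i j → (i , j) ∈ valleysFrom 0 0 (β ++ N ∷ []) → g j ℤ.< f i
    below i j m with c i j (subst ((i , j) ∈_) (valleys-∷ʳ 0 0 β) m) | j ℕ.≤? n
    ... | p , _ | yes j≤n = p j≤n
    ... | _ , q | no  j≰n = q (ℕₚ.≰⇒> j≰n)

-- The bijection

-- Each item raises the level by at most one. With at most n items after the leading zero no level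
-- exceeds n, so the n + 1 blocks of ζ see everything.
dyck-below : ∀ {k x m} A → Linked _⊲_ ((k , x) ∷ A) → suc (k ℕ.+ length A) ≤ m → Below m ((k , x) ∷ A)
dyck-below {k} []      _             p = subst (λ v → suc v ≤ _) (ℕₚ.+-identityʳ k) p ∷ []
dyck-below {k} ((l , _) ∷ A) ((r , _) ∷ d) p =
    ℕₚ.≤-trans (s≤s (ℕₚ.m≤m+n k _)) p
  ∷ dyck-below A d (ℕₚ.≤-trans (s≤s (ℕₚ.≤-trans (ℕₚ.+-monoˡ-≤ (length A) r) (ℕₚ.≤-reflexive (sym (ℕₚ.+-suc k (length A)))))) p)

length-pos : ∀ s → length (pos s) ≤ length s
length-pos []                   = z≤n
length-pos ((+ _      , _) ∷ s) = s≤s (length-pos s)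
length-pos ((-[1+ _ ] , _) ∷ s) = ℕₚ.m≤n⇒m≤1+n (length-pos s)

length-neg : ∀ s → length (neg s) ≤ length s
length-neg []                   = z≤n
length-neg ((+ zero   , _) ∷ s) = s≤s (length-neg s)
length-neg ((+ suc _  , _) ∷ s) = ℕₚ.m≤n⇒m≤1+n (length-neg s)
length-neg ((-[1+ _ ] , _) ∷ s) = s≤s (length-neg s)

upper mirror : List Point → List Item
upper s  = (0 , + 0) ∷ pos s
mirror s = reverse (neg s)

zeros-mirror : ∀ s → zeros (mirror s) ≡ reverse (map -_ (zeros (pos s)))
zeros-mirror s = trans (zeros-reverse (neg s)) (cong reverse (zeros-neg s))

map-neg-involutive : ∀ xs → map -_ (map -_ xs) ≡ xs
map-neg-involutive []       = refl
map-neg-involutive (x ∷ xs) = cong₂ _∷_ (ℤₚ.neg-involutive x) (map-neg-involutive xs)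

reverse-neg-involutive : ∀ xs → reverse (map -_ (reverse (map -_ xs))) ≡ xs
reverse-neg-involutive xs = begin
  reverse (map -_ (reverse (map -_ xs))) ≡⟨ cong reverse (reverse-map -_ (map -_ xs)) ⟩
  reverse (reverse (map -_ (map -_ xs))) ≡⟨ reverse-involutive (map -_ (map -_ xs)) ⟩
  map -_ (map -_ xs)                     ≡⟨ map-neg-involutive xs ⟩
  xs                                     ∎
  where open ≡-Reasoning

zeros-pos : ∀ s → zeros (pos s) ≡ reverse (map -_ (zeros (mirror s)))
zeros-pos s = sym (trans (cong (reverse ∘ map -_) (zeros-mirror s)) (reverse-neg-involutive (zeros (pos s))))

at-zero : ∀ u → at u 0 ≡ + 0
at-zero []      = refl
at-zero (_ ∷ _) = refl

length-oneTo : ∀ n → length (oneTo n) ≡ n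
length-oneTo n = trans (length-map suc (upTo n)) (length-upTo n)

length-signed : ∀ {n u} → IsSignedPerm n u → length u ≡ n
length-signed {n} {u} p = trans (sym (length-map ∣_∣ u)) (trans (↭-length p) (length-oneTo n))

module Vertical (n : ℕ) (π : List Step) (u : List ℤ) (vert : InVert n π u) where

  countE≡n : countE π ≡ n
  countE≡n = proj₁ (proj₁ vert)

  countN≡n : countN π ≡ n
  countN≡n = proj₂ (proj₁ vert)

  signed : IsSignedPerm n u
  signed = proj₁ (proj₂ vert)

  s : List Point
  s = points (at u) (+ 0) 0 π

  length-s : length s ≡ n
  length-s = trans (length-points (at u) (+ 0) 0 π) countN≡n

  labels-s : map proj₂ s ≡ u
  labels-s = trans (labels-points (at u) (+ 0) 0 π)
    (trans (cong (applyUpTo (at u ∘ suc)) (trans countN≡n (sym (length-signed signed)))) (at-applyUpTo u))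

  linked : Linked _◁_ ((+ 0 , + 0) ∷ s)
  linked = subst (λ x → Linked _◁_ ((+ 0 , x) ∷ s)) (at-zero u)
    (rises⇒linked (at u) 0 π
      (subst (ℤ._< at u 1) (sym (at-zero u)) ∘ proj₂ (proj₂ (proj₂ vert)))
      (proj₁ (proj₂ (proj₂ vert))))

  last-nonneg : Last NonNeg s
  last-nonneg = last-tail s (points-last (at u) (+ 0) (+ 0) {+ 0} 0 π ℤₚ.≤-refl (cong +_ (trans countN≡n (sym countE≡n))))

  dyck-upper : Dyck (upper s)
  dyck-upper = refl , pos-linked₀ s linked

  dyck-mirror : Dyck (mirror s)
  dyck-mirror = dyck-reverse (neg s) (neg-codyck s (Linked.tail linked) last-nonneg)

  below-upper : Below (suc n) (upper s)
  below-upper = dyck-below (pos s) (proj₂ dyck-upper) (s≤s (subst (length (pos s) ≤_) length-s (length-pos s)))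

  below-mirror : Below (suc n) (mirror s)
  below-mirror = bound (mirror s) dyck-mirror
    (subst₂ _≤_ (sym (length-reverse (neg s))) length-s (length-neg s))
    where
    bound : ∀ B → Dyck B → length B ≤ n → Below (suc n) B
    bound []      _          _ = []
    bound (_ ∷ B) (refl , l) p = dyck-below B l (ℕₚ.m≤n⇒m≤1+n p)

  R : List Letter
  R = bfs (suc n) (pos s) (mirror s)

  word Z V : List ℤ
  word = order (suc n) (pos s) (mirror s)
  Z    = zeros (mirror s)
  V    = labelsE R

  dC≡ : dC n π u ≡ word
  dC≡ = dC-order n π u countN≡n

  steps : map proj₁ R ≡ reverse (zetaC n π)
  steps = sym (zeta-bfs n π u countN≡n)

  namesN : labelsN R ≡ zeros (pos s) ++ word
  -- `lower` discards the leading zero, so the code of the enlarged half computes to `(N , + 0) ∷ R`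
  -- and `order` does not change; one letter is stripped off.
  namesN = ∷-injectiveʳ (labelsN-order (suc n) (upper s) (mirror s) below-upper)

  -- Two descriptions of the labels of the N's, by the reading order and by the reappearing E's,
  -- both begin with `zeros (pos s)`, which is cancelled.
  word≡ : word ≡ Z ++ V
  word≡ = ++-cancelˡ (zeros (pos s)) _ _ (trans (sym namesN)
    (∷-injectiveʳ (labelsN-bfs (suc n) (upper s) (mirror s) below-upper below-mirror)))

  signed-word : IsSignedPerm n word
  signed-word = ↭-trans (abs-order-↭ (suc n) s (All.tail below-upper) below-mirror)
    (subst (λ x → map ∣_∣ x ↭ oneTo n) (sym labels-s) signed)

  ballot : Ballot R
  ballot = proj₂ (bfs-ballot (suc n) (upper s) (mirror s) below-upper below-mirror)

  rise : Linked Rise ((N , + 0) ∷ R)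
  rise = bfs-rise (suc n) dyck-upper dyck-mirror

well-defined : ∀ n π u → InVert n π u → InDiag n (zetaC n π) (dC n π u)
well-defined n π u vert = subst (InDiag n (zetaC n π)) (sym (trans dC≡ word≡))
  ((length-zeta , ballot⇒prefixes (zetaC n π) R steps ballot) , signed-ZV ,
   subst (λ m → ∀ i j → (i , j) ∈ valleys (zetaC n π) →
     (j ≤ m → at w (suc m ∸ j) ℤ.< at w (suc m ∸ i)) × (m ℕ.< j → - at w (j ∸ m) ℤ.< at w (suc m ∸ i)))
     length-w (D.rise⇒valleys rise))
  where
  open Vertical n π u vert
  names = trans namesN (cong₂ _++_ (zeros-pos s) word≡)
  module D = Diagonal Z V (zetaC n π) R steps names refl
  w = Z ++ V
  signed-ZV : IsSignedPerm n w
  signed-ZV = subst (IsSignedPerm n) word≡ signed-word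
  length-w : length w ≡ n
  length-w = length-signed signed-ZV
  length-zeta : length (zetaC n π) ≡ n ℕ.+ n
  length-zeta = begin
    length (zetaC n π)                    ≡⟨ length-reverse (zetaC n π) ⟨
    length (reverse (zetaC n π))          ≡⟨ cong length steps ⟨
    length (map proj₁ R)                  ≡⟨ length-count (map proj₁ R) ⟨
    countE (map proj₁ R) ℕ.+ countN (map proj₁ R) ≡⟨ cong₂ ℕ._+_ (countE-steps R) (countN-steps R) ⟩
    length V ℕ.+ length (labelsN R)       ≡⟨ cong (λ x → length V ℕ.+ x) (trans (cong length names) (length-++ (reverse (map -_ Z)))) ⟩
    length V ℕ.+ (length (reverse (map -_ Z)) ℕ.+ length w) ≡⟨ cong (λ x → length V ℕ.+ (x ℕ.+ length w)) (trans (length-reverse (map -_ Z)) (length-map -_ Z)) ⟩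
    length V ℕ.+ (length Z ℕ.+ length w)  ≡⟨ ℕₚ.+-assoc (length V) _ _ ⟨
    (length V ℕ.+ length Z) ℕ.+ length w  ≡⟨ cong (ℕ._+ length w) (trans (ℕₚ.+-comm (length V) _) (sym (length-++ Z))) ⟩
    length w ℕ.+ length w                 ≡⟨ cong₂ ℕ._+_ length-w length-w ⟩
    n ℕ.+ n                               ∎
    where open ≡-Reasoning

-- The images determine the labelled code: the number of zeros gives the cut of the window into `Z`
-- and `V`, and the cut gives all labels. Equal codes give equal halves, hence equal points.
injective : ∀ n π π′ u u′ → InVert n π u → InVert n π′ u′ →
  zetaC n π ≡ zetaC n π′ → dC n π u ≡ dC n π′ u′ → (π ≡ π′) × (u ≡ u′)
injective n π π′ u u′ vert vert′ eζ ed =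
    heights-injective (+ 0) π π′ (trans V₁.countE≡n (sym V₂.countE≡n))
      (trans (sym (levels-points (at u) (+ 0) 0 π)) (trans (cong (map proj₁) s≡) (levels-points (at u′) (+ 0) 0 π′)))
  , trans (sym V₁.labels-s) (trans (cong (map proj₂) s≡) V₂.labels-s)
  where
  module V₁ = Vertical n π u vert
  module V₂ = Vertical n π′ u′ vert′
  open ≡-Reasoning
  word≡ : V₁.word ≡ V₂.word
  word≡ = trans (sym V₁.dC≡) (trans ed V₂.dC≡)
  steps≡ : map proj₁ V₁.R ≡ map proj₁ V₂.R
  steps≡ = trans V₁.steps (trans (cong reverse eζ) (sym V₂.steps))
  length-namesN : ∀ R xs {ys} → labelsN R ≡ xs ++ ys → countN (map proj₁ R) ≡ length xs ℕ.+ length ys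
  length-namesN R xs e = trans (countN-steps R) (trans (cong length e) (length-++ xs))
  -- The number of N's determines the number of zeros, since d_C has length n.
  lengths : length (zeros (pos V₁.s)) ≡ length (zeros (pos V₂.s))
  lengths = ℕₚ.+-cancelʳ-≡ (length V₂.word) _ _ (begin
    length (zeros (pos V₁.s)) ℕ.+ length V₂.word ≡⟨ cong (λ x → length (zeros (pos V₁.s)) ℕ.+ length x) word≡ ⟨
    length (zeros (pos V₁.s)) ℕ.+ length V₁.word ≡⟨ length-namesN V₁.R (zeros (pos V₁.s)) V₁.namesN ⟨
    countN (map proj₁ V₁.R)                      ≡⟨ cong countN steps≡ ⟩
    countN (map proj₁ V₂.R)                      ≡⟨ length-namesN V₂.R (zeros (pos V₂.s)) V₂.namesN ⟩
    length (zeros (pos V₂.s)) ℕ.+ length V₂.word ∎)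
  length-Z : ∀ s → length (zeros (mirror s)) ≡ length (zeros (pos s))
  length-Z s = trans (cong length (zeros-mirror s)) (trans (length-reverse (map -_ (zeros (pos s)))) (length-map -_ (zeros (pos s))))
  lengths-Z : length V₁.Z ≡ length V₂.Z
  lengths-Z = trans (length-Z V₁.s) (trans lengths (sym (length-Z V₂.s)))
  cut : V₁.Z ≡ V₂.Z × V₁.V ≡ V₂.V
  cut = ++-injective V₁.Z V₂.Z lengths-Z (trans (sym V₁.word≡) (trans word≡ V₂.word≡))
  zeros≡ : zeros (pos V₁.s) ≡ zeros (pos V₂.s)
  zeros≡ = trans (zeros-pos V₁.s) (trans (cong (reverse ∘ map -_) (proj₁ cut)) (sym (zeros-pos V₂.s)))
  R≡ : V₁.R ≡ V₂.R
  R≡ = word-ext V₁.R V₂.R steps≡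
    (trans V₁.namesN (trans (cong₂ _++_ zeros≡ word≡) (sym V₂.namesN))) (proj₂ cut)
  halves : upper V₁.s ≡ upper V₂.s × mirror V₁.s ≡ mirror V₂.s
  halves = bfs-injective (suc n) V₁.dyck-upper V₁.dyck-mirror V₂.dyck-upper V₂.dyck-mirror
    V₁.below-upper V₁.below-mirror V₂.below-upper V₂.below-mirror (cong suc lengths) lengths-Z
    (cong ((N , + 0) ∷_) R≡)
  s≡ : V₁.s ≡ V₂.s
  s≡ = begin
    V₁.s                          ≡⟨ join-pos-neg V₁.s (Linked.tail V₁.linked) ⟨
    join (pos V₁.s) (neg V₁.s)    ≡⟨ cong₂ join (∷-injectiveʳ (proj₁ halves)) (reverse-injective (proj₂ halves)) ⟩
    join (pos V₂.s) (neg V₂.s)    ≡⟨ join-pos-neg V₂.s (Linked.tail V₂.linked) ⟩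
    V₂.s                          ∎

surjective : ∀ n β w → InDiag n β w →
  Σ (List Step) λ π → Σ (List ℤ) λ u → InVert n π u × (zetaC n π ≡ β) × (dC n π u ≡ w)
surjective n β w ((length-β , prefixes) , signed , valley) = result
  where
  open ≡-Reasoning
  length-w : length w ≡ n
  length-w = length-signed signed
  e≤n : countE β ≤ n
  -- The ballot condition for the whole word gives #E ≤ #N, so more than n E's would make β longer
  -- than 2n.
  e≤n = ℕₚ.≮⇒≥ λ n<e → ℕₚ.<-irrefl (sym (trans (length-count β) length-β))
    (ℕₚ.+-mono-< n<e (ℕₚ.<-≤-trans n<e
      (subst (λ x → countE x ≤ countN x) (take-all (length β) β ℕₚ.≤-refl) (prefixes (length β)))))
  z : ℕ
  -- Forced: in a code the E's carry the whole window except the labels of the zeros of the mirrored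
  -- half.
  z = n ∸ countE β
  Z V : List ℤ
  Z = take z w
  V = drop z w
  ZV : Z ++ V ≡ w
  ZV = take++drop≡id z w
  length-Z : length Z ≡ z
  length-Z = trans (length-take z w) (ℕₚ.m≤n⇒m⊓n≡m (subst (z ≤_) (sym length-w) (ℕₚ.m∸n≤m n (countE β))))
  length-V : length V ≡ countE β
  length-V = trans (length-drop z w) (trans (cong (_∸ z) length-w) (ℕₚ.m∸[m∸n]≡n e≤n))
  namesN₀ : List ℤ
  namesN₀ = reverse (map -_ Z) ++ (Z ++ V)
  countN-β : countN β ≡ length namesN₀
  countN-β = ℕₚ.+-cancelˡ-≡ (countE β) _ _ (begin
    countE β ℕ.+ countN β          ≡⟨ length-count β ⟩
    length β                       ≡⟨ length-β ⟩
    n ℕ.+ n                        ≡⟨ cong (ℕ._+ n) (ℕₚ.m+[n∸m]≡n e≤n) ⟨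
    (countE β ℕ.+ z) ℕ.+ n         ≡⟨ ℕₚ.+-assoc (countE β) z n ⟩
    countE β ℕ.+ (z ℕ.+ n)         ≡⟨ cong (countE β ℕ.+_) (begin
      length namesN₀                                    ≡⟨ length-++ (reverse (map -_ Z)) ⟩
      length (reverse (map -_ Z)) ℕ.+ length (Z ++ V)   ≡⟨ cong₂ ℕ._+_ (trans (length-reverse (map -_ Z)) (trans (length-map -_ Z) length-Z)) (trans (cong length ZV) length-w) ⟩
      z ℕ.+ n                                           ∎) ⟨
    countE β ℕ.+ length namesN₀    ∎)
  R : List Letter
  R = spell (reverse β) namesN₀ V
  spelled : map proj₁ R ≡ reverse β × labelsN R ≡ namesN₀ × labelsE R ≡ V
  spelled = spell-correct (reverse β) namesN₀ V
    (trans (countN-reverse β) countN-β) (trans (countE-reverse β) (sym length-V))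
  steps  = proj₁ spelled
  namesN = proj₁ (proj₂ spelled)
  namesE = proj₂ (proj₂ spelled)
  module D = Diagonal Z V β R steps namesN namesE
  rise : Linked Rise ((N , + 0) ∷ R)
  rise = D.valleys⇒rise (subst₂ (λ m x → ∀ i j → (i , j) ∈ valleys β →
     (j ≤ m → at x (suc m ∸ j) ℤ.< at x (suc m ∸ i)) × (m ℕ.< j → - at x (j ∸ m) ℤ.< at x (suc m ∸ i)))
     (sym (trans (cong length ZV) length-w)) (sym ZV) valley)
  ballot : Ballot ((N , + 0) ∷ R)
  ballot = ballot-++ ((N , + 0) ∷ []) R (ballot-head R b) b
    where
    b : Ballot R
    b = prefixes⇒ballot β R steps prefixes
  decoding : Decoding (suc n) (+ 0 ∷ reverse (map -_ Z)) Z ((N , + 0) ∷ R)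
  decoding = decode (suc n) _ Z ((N , + 0) ∷ R) refl rise ballot
    (cong (+ 0 ∷_) (trans namesN (cong (λ x → reverse (map -_ Z) ++ (Z ++ x)) (sym namesE))))
    -- At most n E's are to be read, so n + 1 levels are enough.
    (inj₂ (s≤s (subst (_≤ n) (sym (trans (cong length namesE) length-V)) e≤n)))
  open Decoding decoding

  fromUpper : ∀ A → zeros A ≡ + 0 ∷ reverse (map -_ Z) → Dyck A →
    Σ (List Item) λ A₁ → A ≡ (0 , + 0) ∷ A₁
  fromUpper ((_ , x) ∷ A₁) e (refl , _) = A₁ , cong (λ v → (0 , v) ∷ A₁) (∷-injectiveˡ e)
  A₁ : List Item
  A₁ = proj₁ (fromUpper A zerosA dyckA)
  A≡ : A ≡ (0 , + 0) ∷ A₁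
  A≡ = proj₂ (fromUpper A zerosA dyckA)
  C : List Item
  C = reverse B
  zerosA₁ : zeros A₁ ≡ reverse (map -_ Z)
  zerosA₁ = ∷-injectiveʳ (trans (cong zeros (sym A≡)) zerosA)
  -- The initial queues were chosen for this: after undoing the reversal, both halves list the same
  -- zeros with opposite labels, as `join` requires.
  match : zeros C ≡ map -_ (zeros A₁)
  match = begin
    zeros (reverse B)             ≡⟨ zeros-reverse B ⟩
    reverse (zeros B)             ≡⟨ cong reverse zerosB ⟩
    reverse Z                     ≡⟨ cong reverse (map-neg-involutive Z) ⟨
    reverse (map -_ (map -_ Z))   ≡⟨ reverse-map -_ (map -_ Z) ⟨
    map -_ (reverse (map -_ Z))   ≡⟨ cong (map -_) zerosA₁ ⟨
    map -_ (zeros A₁)             ∎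
  s : List Point
  s = join A₁ C
  good : Good ((+ 0 , + 0) ∷ s)
  good = join-good₊ A₁ C (proj₂ (subst Dyck A≡ dyckA)) (codyck-reverse B dyckB) match
  pos≡ : pos s ≡ A₁
  pos≡ = pos-join A₁ C match
  mirror≡ : mirror s ≡ B
  mirror≡ = trans (cong reverse (neg-join A₁ C match)) (reverse-involutive B)
  below₁ : Below (suc n) A₁
  below₁ = All.tail (subst (Below (suc n)) A≡ belowA)
  code₁ : bfs (suc n) A₁ B ≡ R
  code₁ = ∷-injectiveʳ (trans (cong (λ x → bfs (suc n) x B) (sym A≡)) code)
  order≡w : order (suc n) (pos s) (mirror s) ≡ w
  order≡w = trans (cong₂ (order (suc n)) pos≡ mirror≡) (trans (++-cancelˡ (reverse (map -_ Z)) _ _ (begin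
    reverse (map -_ Z) ++ order (suc n) A₁ B ≡⟨ cong (_++ order (suc n) A₁ B) zerosA₁ ⟨
    zeros A₁ ++ order (suc n) A₁ B           ≡⟨ labelsN-order (suc n) A₁ B below₁ ⟨
    labelsN (bfs (suc n) A₁ B)               ≡⟨ cong labelsN code₁ ⟩
    labelsN R                                ≡⟨ namesN ⟩
    namesN₀                                  ∎)) ZV)
  u : List ℤ
  u = map proj₂ s
  signed-u : IsSignedPerm n u
  signed-u = ↭-trans (↭-sym (abs-order-↭ (suc n) s (subst (Below (suc n)) (sym pos≡) below₁) (subst (Below (suc n)) (sym mirror≡) belowB)))
    (subst (λ x → map ∣_∣ x ↭ oneTo n) (sym order≡w) signed)
  π-spec = path s good
  π : List Step
  π = proj₁ π-spec
  levels-π : heights (+ 0) π ≡ map proj₁ s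
  levels-π = proj₁ (proj₂ π-spec)
  countN≡length : countN π ≡ length u
  countN≡length = trans (proj₁ (proj₂ (proj₂ π-spec))) (sym (length-map proj₂ s))
  countN≡n : countN π ≡ n
  countN≡n = trans countN≡length (length-signed signed-u)
  countE≡n : countE π ≡ n
  countE≡n = trans (sym (ℤₚ.+-injective (proj₂ (proj₂ (proj₂ π-spec))))) countN≡n
  points≡s : points (at u) (+ 0) 0 π ≡ s
  points≡s = list-ext (trans (levels-points (at u) (+ 0) 0 π) levels-π)
    (trans (labels-points (at u) (+ 0) 0 π) (trans (cong (applyUpTo (at u ∘ suc)) countN≡length) (at-applyUpTo u)))
  linked : Linked _◁_ ((+ 0 , + 0) ∷ points (at u) (+ 0) 0 π)
  linked = subst (λ x → Linked _◁_ ((+ 0 , + 0) ∷ x)) (sym points≡s) (proj₁ good)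
  start : ∀ ρ → Linked _◁_ ((+ 0 , + 0) ∷ points (at u) (+ 0) 0 ρ) → startsWithN ρ → + 0 ℤ.< at u 1
  start (N ∷ _) ((_ , t) ∷ _) _ = t refl
  zeta≡ : zetaC n π ≡ β
  zeta≡ = reverse-injective (begin
    reverse (zetaC n π)                            ≡⟨ zeta-bfs n π u countN≡n ⟩
    map proj₁ (bfs (suc n) (pos s₀) (mirror s₀))   ≡⟨ cong (λ x → map proj₁ (bfs (suc n) (pos x) (mirror x))) points≡s ⟩
    map proj₁ (bfs (suc n) (pos s) (mirror s))     ≡⟨ cong₂ (λ x y → map proj₁ (bfs (suc n) x y)) pos≡ mirror≡ ⟩
    map proj₁ (bfs (suc n) A₁ B)                   ≡⟨ cong (map proj₁) code₁ ⟩
    map proj₁ R                                    ≡⟨ steps ⟩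
    reverse β                                      ∎)
    where s₀ = points (at u) (+ 0) 0 π
  dC≡ : dC n π u ≡ w
  dC≡ = trans (dC-order n π u countN≡n)
    (trans (cong (λ x → order (suc n) (pos x) (mirror x)) points≡s) order≡w)
  result : Σ (List Step) λ π → Σ (List ℤ) λ u → InVert n π u × (zetaC n π ≡ β) × (dC n π u ≡ w)
  result = π , u ,
    ((countE≡n , countN≡n) , signed-u , linked⇒rises (at u) (+ 0) 0 π (Linked.tail linked) , start π linked) ,
    zeta≡ , dC≡

theorem4p18 : (n : ℕ) → 1 ≤ n →
    ((π : List Step) (u : List ℤ) → InVert n π u → InDiag n (zetaC n π) (dC n π u))
    × ((π π′ : List Step) (u u′ : List ℤ) → InVert n π u → InVert n π′ u′ →
    zetaC n π ≡ zetaC n π′ → dC n π u ≡ dC n π′ u′ → (π ≡ π′) × (u ≡ u′))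
    × ((β : List Step) (w : List ℤ) → InDiag n β w →
    Σ (List Step) (λ π → Σ (List ℤ) (λ u →
    InVert n π u × (zetaC n π ≡ β) × (dC n π u ≡ w))))
theorem4p18 n _ = well-defined n , injective n , surjective n
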